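{- Let $\mathfrak{L}$ be a computable language, let $C$ be a $\Delta_2$ cohesive set, and let $n \in \mathbb{N}$. (1) Let $(\mathcal{A}_i : i \in \mathbb{N})$ be a uniformly $n$-decidable sequence of $\mathfrak{L}$-structures. Then $\prod_C \mathcal{A}_i$ realizes every computable $\Sigma_{n+1}$-type over a uniformly partial computable sequence of parameters. In particular, $\prod_C \mathcal{A}_i$ is $\Sigma_{n+1}$-recursively saturated. (2) Let $\mathcal{A}$ be an $n$-decidable $\mathfrak{L}$-structure. Then $\prod_C \mathcal{A}$ realizes every computable $\Sigma_{n+1}$-type over a uniformly partial computable sequence of parameters. In particular, $\prod_C \mathcal{A}$ is $\Sigma_{n+1}$-recursively saturated.
   Context: $\Delta_2$ (for subsets of $\mathbb{N}$) refers to the arithmetical hierarchy; c.e. means computably enumerable. $X \subseteq^* Y$ means that $X \setminus Y$ is finite. A set $C \subseteq \mathbb{N}$ is cohesive if it is infinite and for every c.e. set $W$, either $C \subseteq^* W$ or $C \subseteq^* \mathbb{N} \setminus W$. A uniformly computable sequence of $\mathfrak{L}$-structures $(\mathcal{A}_i : i \in \mathbb{N})$ consists of a uniformly computable sequence of non-empty domains $|\mathcal{A}_i| \subseteq \mathbb{N}$ with uniformly computable interpretations of all symbols of $\mathfrak{L}$; equivalently, the atomic diagrams are uniformly computable. A structure is computable if its atomic diagram is computable (with domain a computable subset of $\mathbb{N}$). A computable structure is $n$-decidable if its $\Sigma_n$-elementary diagram is computable; a uniformly computable sequence of structures is uniformly $n$-decidable if the corresponding sequence of $\Sigma_n$-elementary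 diagrams is uniformly computable. ($0$-decidable is the same as computable.) Cohesive product: let $(\mathcal{A}_i : i \in \mathbb{N})$ be a uniformly computable sequence of $\mathfrak{L}$-structures and $C$ a cohesive set. Let $D$ be the set of partial computable functions $\varphi$ such that $\varphi(i) \in |\mathcal{A}_i|$ whenever $\varphi(i)\downarrow$, and $C \subseteq^* \mathrm{dom}(\varphi)$. For $\varphi,\psi \in D$ let $\varphi =_C \psi$ if $C \subseteq^* \{i : \varphi(i)\downarrow = \psi(i)\downarrow\}$, an equivalence relation with classes $[\varphi]$. The cohesive product $\prod_C \mathcal{A}_i$ is the $\mathfrak{L}$-structure with domain $\{[\varphi] : \varphi \in D\}$, in which: a relation $R([\varphi_0], \dots, [\varphi_{m-1}])$ holds iff $C \subseteq^* \{i : \mathcal{A}_i \models R(\varphi_0(i), \dots, \varphi_{m-1}(i))\}$ (including that all $\varphi_j(i)\downarrow$); $f([\varphi_0], \dots, [\varphi_{m-1}]) = [\psi]$ where $\psi(i) \simeq f^{\mathcal{A}_i}(\varphi_0(i), \dots, \varphi_{m-1}(i))$; and a constant $c$ is interpreted as the class of $i \mapsto c^{\mathcal{A}_i}$. If every $\mathcal{A}_i$ is the same computable structure $\mathcal{A}$, this is the cohesive power $\prod_C \mathcal{A}$. Types: let $\mathcal{M}$ be an $\mathfrak{L}$-structure and $E \subseteq |\mathcal{M}|$ a set of parameters, enumerated as a finite or infinite sequence and named by fresh constant symbols. A type of $\mathcal{M}$ over $E$ is a set $p(\vec{x})$ of formulas with parameters from $E$ in fixed finitely many free variables $\vec{x}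 = x_0, \dots, x_{m-1}$ that is finitely satisfied in $\mathcal{M}$. It is realized if there is a tuple $\vec{a}$ from $|\mathcal{M}|$ with $\mathcal{M} \models \Phi(\vec{a})$ for all $\Phi \in p$. It is a $\Sigma_k$-type if every formula in it is $\Sigma_k$, and it is computable if it is computable as a set of formulas (with the constants for the parameters indexed by their position in the enumeration). $\mathcal{M}$ is $\Sigma_k$-recursively saturated if it realizes every computable $\Sigma_k$-type over a finite set of parameters. A sequence $([\psi_\ell] : \ell \in \mathbb{N})$ of elements of a cohesive product is uniformly partial computable if the sequence of representatives $(\psi_\ell : \ell \in \mathbb{N})$ is uniformly partial computable. -}

module Defs where

open import Data.Bool.Base using (Bool; T)
open import Data.Bool.Properties using (T-irrelevant)
open import Data.Empty using (⊥-elim)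
open import Data.Fin.Base using (Fin; zero; suc; toℕ)
open import Data.List.Base as List using (List)
open import Data.List.Membership.Propositional using () renaming (_∈_ to _∈ˡ_)
open import Data.List.Membership.Propositional.Properties using (∈-++⁺ˡ; ∈-++⁺ʳ)
open import Data.List.Membership.DecPropositional using (_∈?_)
open import Data.List.Relation.Unary.All as ListAll using ()
open import Data.Nat.Base using (ℕ; zero; suc; _+_; _<_)
open import Data.Nat.Properties using (_≟_; <-cmp)
open import Data.Product.Base using (∃; ∃₂; _×_; _,_; proj₁; proj₂)
open import Data.Sum.Base as Sum using (_⊎_)
open import Data.Vec.Base using (Vec; []; _∷_; head; tail; lookup; map; tabulate)
open import Data.Vec.Properties using (tabulate∘lookup)
open import Data.Vec.Relation.Binary.Pointwise.Inductive as Pointwise using (Pointwise; []; _∷_)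
open import Function.Base using (id; _∘_)
open import Function.Bundles using (_⇔_)
open import Level using (Lift; 0ℓ)
open import Relation.Binary.Definitions using (tri<; tri≈; tri>)
open import Relation.Binary.PropositionalEquality using (_≡_; refl; sym; cong; cong₂; subst)
open import Relation.Binary.PropositionalEquality.Properties using (isEquivalence)
open import Relation.Binary.Structures using (IsEquivalence)
open import Relation.Nullary using (¬_; yes; no)
open import Relation.Unary using (Pred; _∩_; _⊆_; _∖_; ∁; _≐_)

-- Kleene's μ-recursive functions.
data Code : ℕ → Set where
  zer  : ∀ {n} → Code n
  succ : Code 1
  proj : ∀ {n} → Fin n → Code n
  comp : ∀ {m n} → Code m → Vec (Code n) m → Code n
  prec : ∀ {n} → Code n → Code (suc (suc n)) → Code (suc n)
  mu   : ∀ {n} → Code (suc n) → Code n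

infix 4 _[_]↓_

-- e [ xs ]↓ y : the partial function with code e is defined on xs with value y.
data _[_]↓_ : ∀ {n} → Code n → Vec ℕ n → ℕ → Set where
  zer↓      : ∀ {n} {xs : Vec ℕ n} → zer [ xs ]↓ 0
  succ↓     : ∀ {x} → succ [ x ∷ [] ]↓ suc x
  proj↓     : ∀ {n} {xs : Vec ℕ n} i → proj i [ xs ]↓ lookup xs i
  comp↓     : ∀ {m n f} {gs : Vec (Code n) m} {xs ys y} →
              Pointwise (λ g → g [ xs ]↓_) gs ys → f [ ys ]↓ y →
              comp f gs [ xs ]↓ y
  prec-zer↓ : ∀ {n} {f : Code n} {g xs y} →
              f [ xs ]↓ y → prec f g [ 0 ∷ xs ]↓ y
  prec-suc↓ : ∀ {n} {f : Code n} {g x xs r y} →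
              prec f g [ x ∷ xs ]↓ r → g [ x ∷ r ∷ xs ]↓ y →
              prec f g [ suc x ∷ xs ]↓ y
  mu↓       : ∀ {n} {f : Code (suc n)} {xs y} →
              f [ y ∷ xs ]↓ 0 →
              (∀ z → z < y → ∃ λ w → f [ z ∷ xs ]↓ suc w) →
              mu f [ xs ]↓ y

dom : Code 1 → Pred ℕ 0ℓ
dom e i = ∃ λ y → e [ i ∷ [] ]↓ y

unary : Pred ℕ 0ℓ → Pred (Vec ℕ 1) 0ℓ
unary X xs = X (head xs)

Computable : ∀ {k} → Pred (Vec ℕ k) 0ℓ → Set
Computable {k} P = ∃ λ (e : Code k) →
  ∀ xs → (P xs × e [ xs ]↓ 1) ⊎ (¬ P xs × e [ xs ]↓ 0)

UniformlyComputable : ∀ {k} → (ℕ → Pred (Vec ℕ k) 0ℓ) → Set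
UniformlyComputable P = Computable (λ xs → P (head xs) (tail xs))

CE : Pred ℕ 0ℓ → Set
CE W = ∃ λ e → W ≐ dom e

Σ⁰ Π⁰ : ℕ → ∀ {k} → Pred (Vec ℕ k) 0ℓ → Set₁
Σ⁰ zero        P = Lift _ (Computable P)
Σ⁰ (suc n) {k} P = ∃ λ (Q : Pred (Vec ℕ (suc k)) 0ℓ) →
  Π⁰ n Q × (∀ xs → P xs ⇔ (∃ λ y → Q (y ∷ xs)))
Π⁰ zero        P = Lift _ (Computable P)
Π⁰ (suc n) {k} P = ∃ λ (Q : Pred (Vec ℕ (suc k)) 0ℓ) →
  Σ⁰ n Q × (∀ xs → P xs ⇔ (∀ y → Q (y ∷ xs)))

Δ⁰ : ℕ → Pred ℕ 0ℓ → Set₁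
Δ⁰ n X = Σ⁰ n (unary X) × Π⁰ n (unary X)

Finite : Pred ℕ 0ℓ → Set
Finite X = ∃ λ (l : List ℕ) → X ⊆ (_∈ˡ l)

infix 4 _⊆*_

_⊆*_ : Pred ℕ 0ℓ → Pred ℕ 0ℓ → Set
X ⊆* Y = Finite (X ∖ Y)

Cohesive : Pred ℕ 0ℓ → Set₁
Cohesive C = ¬ Finite C × (∀ W → CE W → C ⊆* W ⊎ C ⊆* ∁ W)

-- Symbols are natural numbers.  Constant symbols are the function symbols of
-- arity 0.  As only computable languages are considered, membership in the sets
-- of symbols may be taken Bool-valued.
record Language : Set where
  field
    isFun isRel : ℕ → Bool

  FunSym : Set
  FunSym = ∃ λ f → T (isFun f)

  RelSym : Set
  RelSym = ∃ λ r → T (isRel r)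

  field
    funArity : FunSym → ℕ
    relArity : RelSym → ℕ

record ComputableLanguage (L : Language) : Set where
  open Language L
  field
    isFun-computable    : Computable (unary (T ∘ isFun))
    isRel-computable    : Computable (unary (T ∘ isRel))
    funArity-computable : ∃ λ (e : Code 1) → ∀ f → e [ proj₁ f ∷ [] ]↓ funArity f
    relArity-computable : ∃ λ (e : Code 1) → ∀ r → e [ proj₁ r ∷ [] ]↓ relArity r

-- There are no quotient types, so the equality of a structure is an
-- equivalence relation respected by all symbols; it interprets "=".
record Structure (L : Language) : Set₁ where
  open Language L
  infix 4 _≈_
  field
    Carrier       : Set
    _≈_           : Carrier → Carrier → Set
    ≈-equivalence : IsEquivalence _≈_
    fun           : (f : FunSym) → Vec Carrier (funArity f) → Carrier
    fun-cong      : ∀ f {as bs} → Pointwise _≈_ as bs → fun f as ≈ fun f bs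
    rel           : (r : RelSym) → Pred (Vec Carrier (relArity r)) 0ℓ
    rel-resp      : ∀ r {as bs} → Pointwise _≈_ as bs → rel r as → rel r bs

-- Terms and formulas with free variables among m de Bruijn indices, and with
-- additional constant symbols named by the elements of P.
data Term (L : Language) (P : Set) (m : ℕ) : Set where
  var : Fin m → Term L P m
  par : P → Term L P m
  app : (f : Language.FunSym L) → Vec (Term L P m) (Language.funArity L f) → Term L P m

infixr 6 _∧′_
infixr 5 _∨′_

data Formula (L : Language) (P : Set) (m : ℕ) : Set where
  eq        : Term L P m → Term L P m → Formula L P m
  atom      : (r : Language.RelSym L) → Vec (Term L P m) (Language.relArity L r) → Formula L P m
  ¬′_       : Formula L P m → Formula L P m
  _∧′_ _∨′_ : Formula L P m → Formula L P m → Formula L P m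
  ∃′_ ∀′_   : Formula L P (suc m) → Formula L P m

data QuantifierFree {L P m} : Formula L P m → Set where
  eq   : ∀ {t u} → QuantifierFree (eq t u)
  atom : ∀ {r ts} → QuantifierFree (atom r ts)
  neg  : ∀ {Φ} → QuantifierFree Φ → QuantifierFree (¬′ Φ)
  and  : ∀ {Φ Ψ} → QuantifierFree Φ → QuantifierFree Ψ → QuantifierFree (Φ ∧′ Ψ)
  or   : ∀ {Φ Ψ} → QuantifierFree Φ → QuantifierFree Ψ → QuantifierFree (Φ ∨′ Ψ)

-- Prenex formulas with at most n blocks of quantifiers, the first of which is
-- existential (IsΣ) or universal (IsΠ); blocks may be empty, and Σ₀ = Π₀ consists
-- of the quantifier-free formulas.
data IsΣ {L P} : ℕ → ∀ {m} → Formula L P m → Set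
data IsΠ {L P} : ℕ → ∀ {m} → Formula L P m → Set

data IsΣ {L} {P} where
  qf    : ∀ {m} {Φ : Formula L P m} → QuantifierFree Φ → IsΣ 0 Φ
  fromΠ : ∀ {n m} {Φ : Formula L P m} → IsΠ n Φ → IsΣ (suc n) Φ
  ∃Σ    : ∀ {n m} {Φ : Formula L P (suc m)} → IsΣ (suc n) Φ → IsΣ (suc n) (∃′ Φ)

data IsΠ {L} {P} where
  qf    : ∀ {m} {Φ : Formula L P m} → QuantifierFree Φ → IsΠ 0 Φ
  fromΣ : ∀ {n m} {Φ : Formula L P m} → IsΣ n Φ → IsΠ (suc n) Φ
  ∀Π    : ∀ {n m} {Φ : Formula L P (suc m)} → IsΠ (suc n) Φ → IsΠ (suc n) (∀′ Φ)

module _ {L : Language} (M : Structure L) {P : Set} (E : P → Structure.Carrier M) where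
  private module M = Structure M

  eval  : ∀ {m} → Vec M.Carrier m → Term L P m → M.Carrier
  evals : ∀ {m k} → Vec M.Carrier m → Vec (Term L P m) k → Vec M.Carrier k
  eval ρ (var x)    = lookup ρ x
  eval ρ (par p)    = E p
  eval ρ (app f ts) = M.fun f (evals ρ ts)
  evals ρ []        = []
  evals ρ (t ∷ ts)  = eval ρ t ∷ evals ρ ts

  Sat : ∀ {m} → Formula L P m → Vec M.Carrier m → Set
  Sat (eq t u)    ρ = eval ρ t M.≈ eval ρ u
  Sat (atom r ts) ρ = M.rel r (evals ρ ts)
  Sat (¬′ Φ)      ρ = ¬ Sat Φ ρ
  Sat (Φ ∧′ Ψ)    ρ = Sat Φ ρ × Sat Ψ ρ
  Sat (Φ ∨′ Ψ)    ρ = Sat Φ ρ ⊎ Sat Ψ ρ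
  Sat (∃′ Φ)      ρ = ∃ λ a → Sat Φ (a ∷ ρ)
  Sat (∀′ Φ)      ρ = ∀ a → Sat Φ (a ∷ ρ)

triangle : ℕ → ℕ
triangle zero    = 0
triangle (suc n) = suc n + triangle n

pair : ℕ → ℕ → ℕ
pair x y = triangle (x + y) + y

encode : ∀ {k} → Vec ℕ k → ℕ
encode []       = 0
encode (x ∷ xs) = suc (pair x (encode xs))

module _ {L : Language} {P : Set} (index : P → ℕ) where

  codeTerm  : ∀ {m} → Term L P m → ℕ
  codeTerms : ∀ {m k} → Vec (Term L P m) k → Vec ℕ k
  codeTerm (var x)    = encode (0 ∷ toℕ x ∷ [])
  codeTerm (par p)    = encode (1 ∷ index p ∷ [])
  codeTerm (app f ts) = encode (2 ∷ proj₁ f ∷ codeTerms ts)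
  codeTerms []        = []
  codeTerms (t ∷ ts)  = codeTerm t ∷ codeTerms ts

  codeFormula : ∀ {m} → Formula L P m → ℕ
  codeFormula (eq t u)    = encode (0 ∷ codeTerm t ∷ codeTerm u ∷ [])
  codeFormula (atom r ts) = encode (1 ∷ proj₁ r ∷ codeTerms ts)
  codeFormula (¬′ Φ)      = encode (2 ∷ codeFormula Φ ∷ [])
  codeFormula (Φ ∧′ Ψ)    = encode (3 ∷ codeFormula Φ ∷ codeFormula Ψ ∷ [])
  codeFormula (Φ ∨′ Ψ)    = encode (4 ∷ codeFormula Φ ∷ codeFormula Ψ ∷ [])
  codeFormula (∃′ Φ)      = encode (5 ∷ codeFormula Φ ∷ [])
  codeFormula (∀′ Φ)      = encode (6 ∷ codeFormula Φ ∷ [])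

  CodesOf : ∀ {m} → Pred (Formula L P m) 0ℓ → Pred (Vec ℕ 1) 0ℓ
  CodesOf p xs = ∃ λ Φ → p Φ × codeFormula Φ ≡ head xs

module _ {L : Language} (M : Structure L) {P : Set} (E : P → Structure.Carrier M) where

  FinitelySatisfied Realized : ∀ {m} → Pred (Formula L P m) 0ℓ → Set
  FinitelySatisfied p = ∀ Φs → ListAll.All p Φs → ∃ λ ρ → ListAll.All (λ Φ → Sat M E Φ ρ) Φs
  Realized          p = ∃ λ ρ → ∀ Φ → p Φ → Sat M E Φ ρ

  -- The parameters are enumerated by E; index p is the position of p.
  RealizesComputableΣTypes : (index : P → ℕ) → ℕ → Set₁
  RealizesComputableΣTypes index k =
    ∀ m (p : Pred (Formula L P m) 0ℓ) →
    FinitelySatisfied p → (∀ Φ → p Φ → IsΣ k Φ) → Computable (CodesOf index p) →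
    Realized p

ΣRecursivelySaturated : ∀ {L} → ℕ → Structure L → Set₁
ΣRecursivelySaturated k M =
  ∀ N (E : Fin N → Structure.Carrier M) → RealizesComputableΣTypes M E toℕ k

-- Structures with domain a subset of ℕ; Bool-valued membership loses no
-- generality, since all domains considered are computable.
record ℕStructure (L : Language) : Set₁ where
  open Language L
  field
    domain : ℕ → Bool

  Elem : Set
  Elem = ∃ λ a → T (domain a)

  field
    nonempty : Elem
    fun      : (f : FunSym) → Vec Elem (funArity f) → Elem
    rel      : (r : RelSym) → Pred (Vec Elem (relArity r)) 0ℓ

  values : ∀ {k} → Vec Elem k → Vec ℕ k
  values = map proj₁

  structure : Structure L
  structure = record
    { Carrier       = Elem
    ; _≈_           = _≡_
    ; ≈-equivalence = isEquivalence
    ; fun           = fun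
    ; fun-cong      = λ f as≡bs → cong (fun f) (Pointwise.Pointwise-≡⇒≡ as≡bs)
    ; rel           = rel
    ; rel-resp      = λ r as≡bs → subst (rel r) (Pointwise.Pointwise-≡⇒≡ as≡bs)
    }

module _ {L : Language} (A : ℕStructure L) where
  open Language L
  open ℕStructure A

  RelationSet : Pred (Vec ℕ 2) 0ℓ
  RelationSet xs = ∃₂ λ (r : RelSym) (as : Vec Elem (relArity r)) →
    rel r as × proj₁ r ∷ encode (values as) ∷ [] ≡ xs

  -- The set of (codes of) Σₙ sentences true in A, with a constant for each
  -- element of the domain.
  ΣDiagram : ℕ → Pred (Vec ℕ 1) 0ℓ
  ΣDiagram n = CodesOf {P = Elem} proj₁ (λ Φ → IsΣ n Φ × Sat structure id Φ [])

  record IsComputable : Set where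
    field
      domain-computable : Computable (unary (T ∘ domain))
      rel-computable    : Computable RelationSet
      fun-computable    : ∃ λ (e : Code 2) →
        ∀ f as → e [ proj₁ f ∷ encode (values as) ∷ [] ]↓ proj₁ (fun f as)

  Decidable : ℕ → Set
  Decidable n = IsComputable × Computable (ΣDiagram n)

module _ {L : Language} (A : ℕ → ℕStructure L) where
  open ℕStructure

  record IsUniformlyComputable : Set where
    field
      domain-computable : UniformlyComputable (λ i → unary (T ∘ domain (A i)))
      rel-computable    : UniformlyComputable (λ i → RelationSet (A i))
      fun-computable    : ∃ λ (e : Code 3) →
        ∀ i f as → e [ i ∷ proj₁ f ∷ encode (values (A i) as) ∷ [] ]↓ proj₁ (fun (A i) f as)

  UniformlyDecidable : ℕ → Set
  UniformlyDecidable n = IsUniformlyComputable × UniformlyComputable (λ i → ΣDiagram (A i) n)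

↓-functional : ∀ {n} {e : Code n} {xs y z} → e [ xs ]↓ y → e [ xs ]↓ z → y ≡ z
↓-functional* : ∀ {m n} {gs : Vec (Code n) m} {xs} {ys zs : Vec ℕ m} →
  Pointwise (λ g → g [ xs ]↓_) gs ys → Pointwise (λ g → g [ xs ]↓_) gs zs → ys ≡ zs
↓-functional zer↓ zer↓ = refl
↓-functional succ↓ succ↓ = refl
↓-functional (proj↓ i) (proj↓ .i) = refl
↓-functional (comp↓ gs f) (comp↓ gs′ f′) with refl ← ↓-functional* gs gs′ = ↓-functional f f′
↓-functional (prec-zer↓ f) (prec-zer↓ f′) = ↓-functional f f′
↓-functional (prec-suc↓ r g) (prec-suc↓ r′ g′) with refl ← ↓-functional r r′ = ↓-functional g g′
↓-functional (mu↓ {y = y} f lt) (mu↓ {y = z} f′ lt′) with <-cmp y z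
... | tri< y<z _ _ with () ← ↓-functional f (proj₂ (lt′ y y<z))
... | tri≈ _ y≡z _ = y≡z
... | tri> _ _ z<y with () ← ↓-functional f′ (proj₂ (lt z z<y))
↓-functional* [] [] = refl
↓-functional* (g ∷ gs) (g′ ∷ gs′) = cong₂ _∷_ (↓-functional g g′) (↓-functional* gs gs′)

constC : ∀ {n} → ℕ → Code n
constC zero    = zer
constC (suc k) = comp succ (constC k ∷ [])

constC↓ : ∀ {n} k {xs : Vec ℕ n} → constC k [ xs ]↓ k
constC↓ zero    = zer↓
constC↓ (suc k) = comp↓ (constC↓ k ∷ []) succ↓

addC : Code 2
addC = prec (proj zero) (comp succ (proj (suc zero) ∷ []))

addC↓ : ∀ x {y} → addC [ x ∷ y ∷ [] ]↓ x + y
addC↓ zero    = prec-zer↓ (proj↓ zero)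
addC↓ (suc x) = prec-suc↓ (addC↓ x) (comp↓ (proj↓ (suc zero) ∷ []) succ↓)

triangleC : Code 1
triangleC = prec zer (comp addC (comp succ (proj zero ∷ []) ∷ proj (suc zero) ∷ []))

triangleC↓ : ∀ x → triangleC [ x ∷ [] ]↓ triangle x
triangleC↓ zero    = prec-zer↓ zer↓
triangleC↓ (suc x) = prec-suc↓ (triangleC↓ x)
  (comp↓ (comp↓ (proj↓ zero ∷ []) succ↓ ∷ proj↓ (suc zero) ∷ []) (addC↓ (suc x)))

pairC : Code 2
pairC = comp addC (comp triangleC (addC ∷ []) ∷ proj (suc zero) ∷ [])

pairC↓ : ∀ x y → pairC [ x ∷ y ∷ [] ]↓ pair x y
pairC↓ x y = comp↓
  (comp↓ (addC↓ x ∷ []) (triangleC↓ (x + y)) ∷ proj↓ (suc zero) ∷ [])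
  (addC↓ (triangle (x + y)))

encodeC : ∀ {k n} → Vec (Code n) k → Code n
encodeC []       = zer
encodeC (g ∷ gs) = comp succ (comp pairC (g ∷ encodeC gs ∷ []) ∷ [])

encodeC↓ : ∀ {k n} {gs : Vec (Code n) k} {xs} {ys : Vec ℕ k} →
  Pointwise (λ g → g [ xs ]↓_) gs ys → encodeC gs [ xs ]↓ encode ys
encodeC↓ []       = zer↓
encodeC↓ (g ∷ gs) = comp↓ (comp↓ (g ∷ encodeC↓ gs ∷ []) (pairC↓ _ _) ∷ []) succ↓

encodeC-defined : ∀ {k n} (gs : Vec (Code n) k) {xs c} →
  encodeC gs [ xs ]↓ c → ∃ λ (ys : Vec ℕ k) → Pointwise (λ g → g [ xs ]↓_) gs ys
encodeC-defined []       _ = [] , []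
encodeC-defined (g ∷ gs) (comp↓ (comp↓ (g↓ ∷ gs↓ ∷ []) _ ∷ []) _) =
  let ys , gs↓ys = encodeC-defined gs gs↓ in _ ∷ ys , g↓ ∷ gs↓ys

dropC : ∀ {k} → Code k → Code (suc k)
dropC e = comp e (tabulate (proj ∘ suc))

dropC↓ : ∀ {k} {e : Code k} {x xs y} → e [ xs ]↓ y → dropC e [ x ∷ xs ]↓ y
dropC↓ {x = x} {xs} = comp↓
  (subst (Pointwise (λ g → g [ x ∷ xs ]↓_) _) (tabulate∘lookup xs)
    (Pointwise.tabulate⁺ (λ i → proj↓ (suc i))))

computable-const : ∀ {k} {P : Pred (Vec ℕ k) 0ℓ} → Computable P → UniformlyComputable (λ _ → P)
computable-const (e , e↓) = dropC e , λ { (x ∷ xs) →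
  Sum.map (λ (p , d) → p , dropC↓ d) (λ (p , d) → p , dropC↓ d) (e↓ xs) }

isComputable-const : ∀ {L} {A : ℕStructure L} → IsComputable A → IsUniformlyComputable (λ _ → A)
isComputable-const cA = record
  { domain-computable = computable-const domain-computable
  ; rel-computable    = computable-const rel-computable
  ; fun-computable    = dropC (proj₁ fun-computable) , λ i f as → dropC↓ (proj₂ fun-computable f as)
  }
  where open IsComputable cA

⊆*-universal : ∀ {C Y} → (∀ i → Y i) → C ⊆* Y
⊆*-universal all = List.[] , λ (_ , ¬y) → ⊥-elim (¬y (all _))

⊆*-mono : ∀ {C Y Z} → Y ⊆ Z → C ⊆* Y → C ⊆* Z
⊆*-mono Y⊆Z (l , sub) = l , λ (c , ¬z) → sub (c , ¬z ∘ Y⊆Z)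

⊆*-∩ : ∀ {C Y Z} → C ⊆* Y → C ⊆* Z → C ⊆* Y ∩ Z
⊆*-∩ {C} {Y} {Z} (l , sub) (l′ , sub′) = l List.++ l′ , λ {i} → go i
  where
  go : ∀ i → (C ∖ (Y ∩ Z)) i → i ∈ˡ l List.++ l′
  go i (c , ¬yz) with _∈?_ _≟_ i l | _∈?_ _≟_ i l′
  ... | yes i∈l | _        = ∈-++⁺ˡ i∈l
  ... | no _    | yes i∈l′ = ∈-++⁺ʳ l i∈l′
  ... | no i∉l  | no i∉l′  =
    ⊥-elim (i∉l (sub (c , λ y → i∉l′ (sub′ (c , λ z → ¬yz (y , z))))))

module CohesiveProduct {L : Language} (A : ℕ → ℕStructure L)
                       (A-computable : IsUniformlyComputable A) (C : Pred ℕ 0ℓ) where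
  open Language L
  private module A i = ℕStructure (A i)

  -- Partial computable functions are represented by codes; different codes
  -- for the same function are identified by _=C_.
  record D : Set where
    field
      code     : Code 1
      inDomain : ∀ {i a} → code [ i ∷ [] ]↓ a → T (A.domain i a)
      C⊆*dom   : C ⊆* dom code
  open D

  infix 4 _=C_ _[_]⇓_

  _=C_ : D → D → Set
  φ =C ψ = C ⊆* λ i → ∃ λ a → code φ [ i ∷ [] ]↓ a × code ψ [ i ∷ [] ]↓ a

  _[_]⇓_ : ∀ {k} → Vec D k → ∀ i → Vec (A.Elem i) k → Set
  φs [ i ]⇓ as = Pointwise (λ φ a → code φ [ i ∷ [] ]↓ proj₁ a) φs as

  =C-equivalence : IsEquivalence _=C_
  =C-equivalence = record
    { refl  = λ {φ} → ⊆*-mono (λ (a , d) → a , d , d) (C⊆*dom φ)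
    ; sym   = ⊆*-mono (λ (a , d , d′) → a , d′ , d)
    ; trans = λ {φ} {ψ} {χ} p q → ⊆*-mono
        (λ { ((a , d , d′) , (b , e , e′)) →
             a , d , subst (code χ [ _ ]↓_) (sym (↓-functional d′ e)) e′ })
        (⊆*-∩ p q)
    }

  allDefined : ∀ {k} (φs : Vec D k) → C ⊆* λ i → ∃ λ as → φs [ i ]⇓ as
  allDefined []       = ⊆*-universal (λ _ → [] , [])
  allDefined (φ ∷ φs) = ⊆*-mono
    (λ ((a , d) , (as , ds)) → (a , inDomain φ d) ∷ as , d ∷ ds)
    (⊆*-∩ (C⊆*dom φ) (allDefined φs))

  allEqual : ∀ {k} {φs ψs : Vec D k} → Pointwise _=C_ φs ψs →
    C ⊆* λ i → ∃ λ as → φs [ i ]⇓ as × ψs [ i ]⇓ as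
  allEqual []       = ⊆*-universal (λ _ → [] , [] , [])
  allEqual (_∷_ {x = φ} p ps) = ⊆*-mono
    (λ ((a , d , e) , (as , ds , es)) → (a , inDomain φ d) ∷ as , d ∷ ds , e ∷ es)
    (⊆*-∩ p (allEqual ps))

  ⇓-functional : ∀ {k} {φs : Vec D k} {i as bs} → φs [ i ]⇓ as → φs [ i ]⇓ bs → as ≡ bs
  ⇓-functional [] [] = refl
  ⇓-functional {as = (_ , p) ∷ _} {(_ , q) ∷ _} (d ∷ ds) (e ∷ es)
    with refl ← ↓-functional d e
    with refl ← T-irrelevant p q
    = cong (_ ∷_) (⇓-functional ds es)

  funC : ∀ (f : FunSym) → Vec D (funArity f) → Code 1
  funC f φs = comp (proj₁ (IsUniformlyComputable.fun-computable A-computable))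
    (proj zero ∷ constC (proj₁ f) ∷ encodeC (map code φs) ∷ [])

  private
    map⁺ : ∀ {k} {φs : Vec D k} {i as} → φs [ i ]⇓ as →
      Pointwise (λ g → g [ i ∷ [] ]↓_) (map code φs) (A.values i as)
    map⁺ []       = []
    map⁺ (d ∷ ds) = d ∷ map⁺ ds

    map⁻ : ∀ {k} (φs : Vec D k) {i} {ys : Vec ℕ k} →
      Pointwise (λ g → g [ i ∷ [] ]↓_) (map code φs) ys → ∃ λ as → φs [ i ]⇓ as
    map⁻ []       []       = [] , []
    map⁻ (φ ∷ φs) (d ∷ ds) = let as , ds′ = map⁻ φs ds in (_ , inDomain φ d) ∷ as , d ∷ ds′

  funC↓ : ∀ f {φs i as} → φs [ i ]⇓ as → funC f φs [ i ∷ [] ]↓ proj₁ (A.fun i f as)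
  funC↓ f {i = i} {as} ds = comp↓
    (proj↓ zero ∷ constC↓ (proj₁ f) ∷ encodeC↓ (map⁺ ds) ∷ [])
    (proj₂ (IsUniformlyComputable.fun-computable A-computable) i f as)

  funC-defined : ∀ f φs {i b} → funC f φs [ i ∷ [] ]↓ b → ∃ λ as → φs [ i ]⇓ as
  funC-defined f φs (comp↓ (_ ∷ _ ∷ d ∷ []) _) =
    map⁻ φs (proj₂ (encodeC-defined (map code φs) d))

  funD : ∀ f → Vec D (funArity f) → D
  funD f φs = record
    { code     = funC f φs
    ; inDomain = λ {i} d → let as , ds = funC-defined f φs d in
        subst (T ∘ A.domain i) (↓-functional (funC↓ f ds) d) (proj₂ (A.fun i f as))
    ; C⊆*dom   = ⊆*-mono (λ (as , ds) → _ , funC↓ f ds) (allDefined φs)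
    }

  relD : ∀ r → Pred (Vec D (relArity r)) 0ℓ
  relD r φs = C ⊆* λ i → ∃ λ as → φs [ i ]⇓ as × A.rel i r as

  product : Structure L
  product = record
    { Carrier       = D
    ; _≈_           = _=C_
    ; ≈-equivalence = =C-equivalence
    ; fun           = funD
    ; fun-cong      = λ f p → ⊆*-mono
        (λ (as , ds , es) → _ , funC↓ f ds , funC↓ f es) (allEqual p)
    ; rel           = relD
    ; rel-resp      = λ r p q → ⊆*-mono
        (λ { {i} ((as , ds , es) , (bs , ds′ , h)) →
             as , es , subst (A.rel i r) (⇓-functional ds′ ds) h })
        (⊆*-∩ (allEqual p) q)
    }

  -- Since elements of the product are classes [ ψ ], representatives may be
  -- chosen anew: e is a code of (ℓ , i) ↦ ψ ℓ (i), with ψ ℓ =C E ℓ for all ℓ.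
  UniformlyPartialComputable : (ℕ → D) → Set
  UniformlyPartialComputable E =
    ∃₂ λ (ψ : ℕ → D) (e : Code 2) → (∀ ℓ → ψ ℓ =C E ℓ) ×
      (∀ ℓ i a → e [ ℓ ∷ i ∷ [] ]↓ a ⇔ code (ψ ℓ) [ i ∷ [] ]↓ a)

  RealizesOverUniformSequences : ℕ → Set₁
  RealizesOverUniformSequences k =
    ∀ E → UniformlyPartialComputable E → RealizesComputableΣTypes product E id k

module CohesivePower {L : Language} (A : ℕStructure L) (A-computable : IsComputable A)
                     (C : Pred ℕ 0ℓ) =
  CohesiveProduct (λ _ → A) (isComputable-const A-computable) C

{-# OPTIONS --safe #-}
module Submission where

-- Let Wₛ be the set of i such that some tuple of 𝒜ᵢ satisfies all formulas of the type p with code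
-- below s.  By Łoś's theorem for Σₙ₊₁ formulas and finite satisfiability C ⊆* Wₛ for every s, and the
-- sets Wₛ are uniformly c.e., because membership is verified by witnesses for the leading existential
-- quantifiers together with the Σₙ diagram.  As C is Σ⁰₂, i ∈ C means that some a satisfies
-- ∀ b R(b , a , i).  For each s let a candidate q consist of some i ≥ s, some a, and a verification of
-- i ∈ Wₛ, and call i selected at s if it comes from a candidate all of whose predecessors q′ are refuted
-- by some b with ¬ R(b , a′ , i′).  No candidate beyond the least true one is selected, so only finitely
-- many i are selected at each s, and the index of the least true one is an element of C above s.  Hence
-- the partial computable map sending i to the tuple of the first s found at which i is selected has a
-- domain meeting C in an infinite set; by cohesiveness its domain contains almost all of C, where s
-- tends to infinity, and so the map realizes p.

open import Defs
open import Axiom.ExcludedMiddle using (ExcludedMiddle)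
open import Data.Bool.Base using (Bool; T)
open import Data.Bool.Properties using (T-irrelevant)
open import Data.Empty using (⊥; ⊥-elim)
open import Data.Fin.Base using (Fin; zero; suc; toℕ; _↑ˡ_; _↑ʳ_; splitAt)
open import Data.Fin.Properties using (toℕ-injective; toℕ<n; toℕ-↑ˡ; toℕ-↑ʳ; splitAt⁻¹-↑ˡ; splitAt⁻¹-↑ʳ)
open import Data.List.Base as List using (List; upTo)
open import Data.List.Membership.Propositional using () renaming (_∈_ to _∈ˡ_)
open import Data.List.Membership.Propositional.Properties using (∈-++⁺ˡ; ∈-++⁺ʳ; ∈-upTo⁺; ∈-map⁺)
open import Data.List.Relation.Unary.All as All using (All)
open import Data.List.Relation.Unary.Any using (here; there)
open import Data.Nat.Base
open import Data.Nat.Properties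
open import Data.Product.Base using (∃; ∃₂; _×_; _,_; proj₁; proj₂)
open import Data.Product.Function.NonDependent.Propositional using (_×-⇔_)
open import Data.Sum.Base as Sum using (_⊎_; inj₁; inj₂)
open import Data.Sum.Function.Propositional using (_⊎-⇔_)
open import Data.Vec.Base using (Vec; []; _∷_; head; tail; lookup; map; _++_; tabulate)
open import Data.Vec.Properties
  using (lookup-map; lookup-++ˡ; lookup-++ʳ; tabulate-∘; tabulate-cong; tabulate∘lookup)
open import Data.Vec.Relation.Binary.Pointwise.Inductive as Pointwise using (Pointwise; []; _∷_)
open import Function.Base using (id; _∘_)
open import Function.Bundles using (_⇔_; mk⇔; Equivalence)
open import Function.Definitions using (Injective)
open import Function.Related.TypeIsomorphisms using (¬-cong-⇔)
open import Level using (0ℓ; lower)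
open import Relation.Binary.PropositionalEquality
open import Relation.Binary.Structures using (IsEquivalence)
open import Relation.Nullary using (¬_; Dec; yes; no; decidable-stable)
open import Relation.Unary using (Pred; ∁)

open Equivalence using (to; from)

-- Recursive functions and computable predicates

-- Sending i to a tuple from the first s found with i ∈ Wₛ would not do: the same small s may turn
-- up for infinitely many i, and a largest s cannot be computed. The selection makes each s
-- available to finitely many i only, without losing all of C. The ∃∀ form of C is what drives it: a
-- false claim that a witnesses i ∈ C is refuted by some b, and a true one never is. Two points of
-- effectivity shape the rest. The diagrams consist of codes of sentences with constants for
-- elements of 𝒜ᵢ, so tuples and parameter values have to be substituted by recursive functions on
-- codes; and since only Σₙ diagrams are given, the Πₙ part left after the leading existential
-- quantifiers is tested through its prenex negation, also formed on codes. Moreover, parameters and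
-- elements of the product are partial functions, so a verification also carries the fuel with which
-- their values are computed, and this fuel is found by the same search as the witnesses. Excluded
-- middle serves for the duality of the quantifiers and for choices that need not be computable,
-- such as the least true candidate.

record Rec {k} (f : Vec ℕ k → ℕ) : Set where
  constructor rec
  field
    code  : Code k
    code↓ : ∀ xs → code [ xs ]↓ f xs
open Rec

record Recs {k m} (fs : Vec ℕ k → Vec ℕ m) : Set where
  constructor recs
  field
    codes  : Vec (Code k) m
    codes↓ : ∀ xs → Pointwise (λ g → g [ xs ]↓_) codes (fs xs)
open Recs

-- A function defined by matching on a vector does not reduce on a variable `xs`. It is therefore
-- described through `lookup`, `head` and `tail`, and the two are compared pointwise after matching.
Rec-≗ : ∀ {k} {f g : Vec ℕ k → ℕ} → (∀ xs → f xs ≡ g xs) → Rec f → Rec g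
Rec-≗ f≗g (rec e e↓) = rec e λ xs → subst (e [ xs ]↓_) (f≗g xs) (e↓ xs)

infixr 5 _∷ᴿ_
infixl 8 _·_

[]ᴿ : ∀ {k} → Recs {k} (λ _ → [])
[]ᴿ = recs [] (λ _ → [])

_∷ᴿ_ : ∀ {k m f} {fs : Vec ℕ k → Vec ℕ m} → Rec f → Recs fs → Recs (λ xs → f xs ∷ fs xs)
rec e e↓ ∷ᴿ recs es es↓ = recs (e ∷ es) λ xs → e↓ xs ∷ es↓ xs

_·_ : ∀ {k m g} {fs : Vec ℕ k → Vec ℕ m} → Rec g → Recs fs → Rec (λ xs → g (fs xs))
rec e e↓ · recs es es↓ = rec (comp e es) λ xs → comp↓ (es↓ xs) (e↓ _)

_·*_ : ∀ {k l m} {gs : Vec ℕ m → Vec ℕ l} {fs : Vec ℕ k → Vec ℕ m} →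
  Recs gs → Recs fs → Recs (λ xs → gs (fs xs))
recs ds ds↓ ·* recs es es↓ = recs (map (λ d → comp d es) ds) λ xs → go xs (ds↓ _)
  where
  go : ∀ xs {l} {ds : Vec (Code _) l} {ys : Vec ℕ l} → Pointwise (λ g → g [ _ ]↓_) ds ys →
    Pointwise (λ g → g [ xs ]↓_) (map (λ d → comp d es) ds) ys
  go xs []       = []
  go xs (d ∷ ds) = comp↓ (es↓ xs) d ∷ go xs ds

arg : ∀ {k} (i : Fin k) → Rec {k} (λ xs → lookup xs i)
arg i = rec (proj i) λ _ → proj↓ i

tailᴿ : ∀ {k} → Recs {suc k} tail
tailᴿ {k} = recs (tabulate (proj ∘ suc)) λ { (x ∷ xs) →
  subst (Pointwise (λ g → g [ x ∷ xs ]↓_) _) (tabulate∘lookup xs)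
    (Pointwise.tabulate⁺ (λ i → proj↓ (suc i))) }

x₀ : ∀ {k} → Rec {1 + k} (λ xs → lookup xs zero)
x₀ = arg zero
x₁ : ∀ {k} → Rec {2 + k} (λ xs → lookup xs (suc zero))
x₁ = arg (suc zero)
x₂ : ∀ {k} → Rec {3 + k} (λ xs → lookup xs (suc (suc zero)))
x₂ = arg (suc (suc zero))
x₃ : ∀ {k} → Rec {4 + k} (λ xs → lookup xs (suc (suc (suc zero))))
x₃ = arg (suc (suc (suc zero)))
x₄ : ∀ {k} → Rec {5 + k} (λ xs → lookup xs (suc (suc (suc (suc zero)))))
x₄ = arg (suc (suc (suc (suc zero))))
x₅ : ∀ {k} → Rec {6 + k} (λ xs → lookup xs (suc (suc (suc (suc (suc zero))))))
x₅ = arg (suc (suc (suc (suc (suc zero)))))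

const : ∀ {k} n → Rec {k} (λ _ → n)
const n = rec (constC n) λ _ → constC↓ n

sucᴿ : ∀ {k f} → Rec {k} f → Rec (λ xs → suc (f xs))
sucᴿ (rec e e↓) = rec (comp succ (e ∷ [])) λ xs → comp↓ (e↓ xs ∷ []) succ↓

primRec : ∀ {k z s} (f : ℕ → Vec ℕ k → ℕ) → Rec z → Rec s →
  (∀ xs → z xs ≡ f 0 xs) → (∀ n xs → s (n ∷ f n xs ∷ xs) ≡ f (suc n) xs) →
  Rec (λ xs → f (head xs) (tail xs))
primRec {k} f (rec z z↓) (rec s s↓) z≡ s≡ = rec (prec z s) λ { (n ∷ xs) → go n xs }
  where
  go : ∀ n xs → prec z s [ n ∷ xs ]↓ f n xs
  go zero    xs = prec-zer↓ (subst (z [ xs ]↓_) (z≡ xs) (z↓ xs))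
  go (suc n) xs = prec-suc↓ (go n xs) (subst (s [ _ ]↓_) (s≡ n xs) (s↓ _))

predᴿ : ∀ {k f} → Rec {k} f → Rec (λ xs → pred (f xs))
predᴿ r = primRec (λ n _ → pred n) (const {0} 0) x₀ (λ _ → refl) (λ _ _ → refl) · (r ∷ᴿ []ᴿ)

infixl 7 _+ᴿ_ _∸ᴿ_

_+ᴿ_ : ∀ {k f g} → Rec {k} f → Rec g → Rec (λ xs → f xs + g xs)
r +ᴿ s = primRec (λ n xs → n + lookup xs zero) x₀ (sucᴿ x₁) (λ _ → refl) (λ _ _ → refl)
  · (r ∷ᴿ s ∷ᴿ []ᴿ)

_∸ᴿ_ : ∀ {k f g} → Rec {k} f → Rec g → Rec (λ xs → f xs ∸ g xs)
r ∸ᴿ s = primRec (λ n xs → lookup xs zero ∸ n) x₀ (predᴿ x₁) (λ _ → refl)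
    (λ n xs → pred[m∸n]≡m∸[1+n] (lookup xs zero) n)
  · (s ∷ᴿ r ∷ᴿ []ᴿ)

ifz : ℕ → ℕ → ℕ → ℕ
ifz zero    x y = x
ifz (suc _) x y = y

ifzᴿ : ∀ {k f g h} → Rec {k} f → Rec g → Rec h → Rec (λ xs → ifz (f xs) (g xs) (h xs))
ifzᴿ r s t = primRec (λ n xs → ifz n (lookup xs zero) (lookup xs (suc zero))) x₀ x₃
    (λ _ → refl) (λ _ _ → refl)
  · (r ∷ᴿ s ∷ᴿ t ∷ᴿ []ᴿ)

Decides : ℕ → Set → Set
Decides b P = (P × b ≡ 1) ⊎ (¬ P × b ≡ 0)

characteristic : ∀ {k} {P : Pred (Vec ℕ k) 0ℓ} → Computable P →
  ∃ λ χ → Rec χ × (∀ xs → Decides (χ xs) (P xs))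
characteristic (e , e↓) = χ , rec e code↓′ , decides
  where
  χ : Vec ℕ _ → ℕ
  χ xs with e↓ xs
  ... | inj₁ _ = 1
  ... | inj₂ _ = 0
  code↓′ : ∀ xs → e [ xs ]↓ χ xs
  code↓′ xs with e↓ xs
  ... | inj₁ (_ , d) = d
  ... | inj₂ (_ , d) = d
  decides : ∀ xs → Decides (χ xs) _
  decides xs with e↓ xs
  ... | inj₁ (p , _) = inj₁ (p , refl)
  ... | inj₂ (p , _) = inj₂ (p , refl)

computable : ∀ {k f} {P : Pred (Vec ℕ k) 0ℓ} → Rec f → (∀ xs → Decides (f xs) (P xs)) → Computable P
computable {P = P} (rec e e↓) dec = e , λ xs → go xs (dec xs)
  where
  go : ∀ xs → Decides _ (P xs) → (P xs × e [ xs ]↓ 1) ⊎ (¬ P xs × e [ xs ]↓ 0)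
  go xs (inj₁ (p , e≡)) = inj₁ (p , subst (e [ xs ]↓_) e≡ (e↓ xs))
  go xs (inj₂ (p , e≡)) = inj₂ (p , subst (e [ xs ]↓_) e≡ (e↓ xs))

decide : ∀ {k} {P : Pred (Vec ℕ k) 0ℓ} → Computable P → ∀ xs → Dec (P xs)
decide (_ , e↓) xs with e↓ xs
... | inj₁ (p , _) = yes p
... | inj₂ (p , _) = no p

computable-resp : ∀ {k} {P Q : Pred (Vec ℕ k) 0ℓ} → (∀ xs → P xs ⇔ Q xs) →
  Computable P → Computable Q
computable-resp {P = P} {Q} P⇔Q (e , e↓) = e , λ xs → go xs (e↓ xs)
  where
  go : ∀ xs → (P xs × e [ xs ]↓ 1) ⊎ (¬ P xs × e [ xs ]↓ 0) →
    (Q xs × e [ xs ]↓ 1) ⊎ (¬ Q xs × e [ xs ]↓ 0)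
  go xs (inj₁ (p , d)) = inj₁ (to (P⇔Q xs) p , d)
  go xs (inj₂ (p , d)) = inj₂ (p ∘ from (P⇔Q xs) , d)

infixl 8 _∙_
infixr 4 _→ᶜ_
infixr 5 _×ᶜ_
infix 6 _≡ᶜ_

_∙_ : ∀ {k m} {P : Pred (Vec ℕ m) 0ℓ} {fs : Vec ℕ k → Vec ℕ m} →
  Computable P → Recs fs → Computable (λ xs → P (fs xs))
c ∙ fsᴿ = let _ , χᴿ , dec = characteristic c in computable (χᴿ · fsᴿ) (λ xs → dec _)

¬ᶜ_ : ∀ {k} {P : Pred (Vec ℕ k) 0ℓ} → Computable P → Computable (λ xs → ¬ P xs)
¬ᶜ_ {P = P} c with characteristic c
... | χ , χᴿ , dec = computable (const 1 ∸ᴿ χᴿ) (λ xs → go (dec xs))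
  where
  go : ∀ {b Q} → Decides b Q → Decides (1 ∸ b) (¬ Q)
  go (inj₁ (p , refl)) = inj₂ ((λ ¬p → ¬p p) , refl)
  go (inj₂ (p , refl)) = inj₁ (p , refl)

_×ᶜ_ : ∀ {k} {P Q : Pred (Vec ℕ k) 0ℓ} → Computable P → Computable Q →
  Computable (λ xs → P xs × Q xs)
c ×ᶜ d with characteristic c | characteristic d
... | χ , χᴿ , dec | ξ , ξᴿ , dec′ = computable (ifzᴿ χᴿ (const 0) ξᴿ) (λ xs → go (dec xs) (dec′ xs))
  where
  go : ∀ {a b P Q} → Decides a P → Decides b Q → Decides (ifz a 0 b) (P × Q)
  go (inj₂ (p , refl)) _               = inj₂ (p ∘ proj₁ , refl)
  go (inj₁ (p , refl)) (inj₁ (q , e≡)) = inj₁ ((p , q) , e≡)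
  go (inj₁ (p , refl)) (inj₂ (q , e≡)) = inj₂ (q ∘ proj₂ , e≡)

_→ᶜ_ : ∀ {k} {P Q : Pred (Vec ℕ k) 0ℓ} → Computable P → Computable Q →
  Computable (λ xs → P xs → Q xs)
c →ᶜ d with characteristic c | characteristic d
... | χ , χᴿ , dec | ξ , ξᴿ , dec′ = computable (ifzᴿ χᴿ (const 1) ξᴿ) (λ xs → go (dec xs) (dec′ xs))
  where
  go : ∀ {a b P Q} → Decides a P → Decides b Q → Decides (ifz a 1 b) (P → Q)
  go (inj₂ (p , refl)) _               = inj₁ (⊥-elim ∘ p , refl)
  go (inj₁ (p , refl)) (inj₁ (q , e≡)) = inj₁ ((λ _ → q) , e≡)
  go (inj₁ (p , refl)) (inj₂ (q , e≡)) = inj₂ ((λ h → q (h p)) , e≡)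

_≡ᶜ_ : ∀ {k f g} → Rec {k} f → Rec g → Computable (λ xs → f xs ≡ g xs)
r ≡ᶜ s = computable (const 1 ∸ᴿ ((r ∸ᴿ s) +ᴿ (s ∸ᴿ r))) (λ xs → go _ _)
  where
  go : ∀ m n → Decides (1 ∸ ((m ∸ n) + (n ∸ m))) (m ≡ n)
  go zero    zero    = inj₁ (refl , refl)
  go zero    (suc n) = inj₂ ((λ ()) , 0∸n≡0 n)
  go (suc m) zero    = inj₂ ((λ ()) , 0∸n≡0 (m + 0))
  go (suc m) (suc n) with go m n
  ... | inj₁ (p , q) = inj₁ (cong suc p , q)
  ... | inj₂ (p , q) = inj₂ (p ∘ suc-injective , q)

∃<ᶜ : ∀ {k f} {P : Pred (Vec ℕ (suc k)) 0ℓ} → Rec {k} f → Computable P →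
  Computable (λ xs → ∃ λ j → j < f xs × P (j ∷ xs))
∃<ᶜ {k} {f} {P} r c with characteristic c
... | χ , χᴿ , dec = computable
    (primRec any (const 0) (ifzᴿ x₁ (χᴿ · (x₀ ∷ᴿ (tailᴿ ·* tailᴿ))) (const 1)) (λ _ → refl)
       (λ _ _ → refl) · (r ∷ᴿ recs _ (codes↓ idᴿ)))
    (λ xs → go (f xs) xs)
  where
  any : ℕ → Vec ℕ k → ℕ
  any zero    xs = 0
  any (suc n) xs = ifz (any n xs) (χ (n ∷ xs)) 1
  idᴿ : Recs {k} id
  idᴿ = recs (tabulate proj) λ xs →
    subst (Pointwise (λ g → g [ xs ]↓_) _) (tabulate∘lookup xs) (Pointwise.tabulate⁺ proj↓)
  go : ∀ n xs → Decides (any n xs) (∃ λ j → j < n × P (j ∷ xs))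
  go zero    xs = inj₂ ((λ ()) , refl)
  go (suc n) xs with any n xs | go n xs
  ... | _ | inj₁ ((j , j<n , p) , refl) = inj₁ ((j , m<n⇒m<1+n j<n , p) , refl)
  ... | _ | inj₂ (none , refl) with dec (n ∷ xs)
  ...   | inj₁ (p , e≡) = inj₁ ((n , n<1+n n , p) , e≡)
  ...   | inj₂ (¬p , e≡) = inj₂ ((λ (j , j<1+n , p) → none (j , ≤∧≢⇒< (≤-pred j<1+n)
          (λ { refl → ¬p p }) , p)) , e≡)

∀<ᶜ : ∀ {k f} {P : Pred (Vec ℕ (suc k)) 0ℓ} → Rec {k} f → Computable P →
  Computable (λ xs → ∀ j → j < f xs → P (j ∷ xs))
∀<ᶜ {f = f} {P} r c = computable-resp
  (λ xs → mk⇔ (no-counterexample xs) (λ all (j , j<n , ¬p) → ¬p (all j j<n))) (¬ᶜ ∃<ᶜ r (¬ᶜ c))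
  where
  no-counterexample : ∀ xs → ¬ (∃ λ j → j < f xs × ¬ P (j ∷ xs)) → ∀ j → j < f xs → P (j ∷ xs)
  no-counterexample xs none j j<n with decide c (j ∷ xs)
  ... | yes p = p
  ... | no ¬p = ⊥-elim (none (j , j<n , ¬p))

-- Evaluation with bounded fuel

-- Asking for all large t, and not for one t, lets finitely many requirements be met by a common
-- fuel.
Eventually : Pred ℕ 0ℓ → Set
Eventually P = ∃ λ t₀ → ∀ t → t₀ ≤ t → P t

eventually-× : ∀ {P Q : Pred ℕ 0ℓ} → Eventually P → Eventually Q → Eventually (λ t → P t × Q t)
eventually-× (a , p) (b , q) = a ⊔ b , λ t le →
  p t (≤-trans (m≤m⊔n a b) le) , q t (≤-trans (m≤n⊔m a b) le)

eventually-map : ∀ {P Q : Pred ℕ 0ℓ} → (∀ {t} → P t → Q t) → Eventually P → Eventually Q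
eventually-map h (t₀ , p) = t₀ , λ t le → h (p t le)

eventually-∀< : ∀ {P : ℕ → Pred ℕ 0ℓ} n → (∀ j → j < n → Eventually (P j)) →
  Eventually (λ t → ∀ j → j < n → P j t)
eventually-∀< zero    _ = 0 , λ _ _ _ ()
eventually-∀< {P} (suc n) h =
  eventually-map combine (eventually-× (h n (n<1+n n)) (eventually-∀< n (λ j j<n → h j (m<n⇒m<1+n j<n))))
  where
  combine : ∀ {t} → P n t × (∀ j → j < n → P j t) → ∀ j → j < suc n → P j t
  combine (p , ps) j j<1+n with m≤n⇒m<n∨m≡n (≤-pred j<1+n)
  ... | inj₁ j<n  = ps j j<n
  ... | inj₂ refl = p

-- In this part 0 stands for a value that is still undefined and `suc y` for the value y; one
-- undefined entry makes the whole tuple undefined.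
guard : ∀ {m} → Vec ℕ m → ℕ
guard []       = 1
guard (y ∷ ys) = ifz y 0 (guard ys)

precRun : ∀ {k} → (Vec ℕ k → ℕ) → (Vec ℕ (2 + k) → ℕ) → ℕ → Vec ℕ k → ℕ
precRun f g zero    xs = f xs
precRun f g (suc x) xs = ifz (precRun f g x xs) 0 (g (x ∷ pred (precRun f g x xs) ∷ xs))

-- muScan f y xs is 0 while no z < y has decided the search, 1 if the search is
-- stuck at an undefined value, and 2 + z if it has found the zero z.
muScan : ∀ {k} → (Vec ℕ (suc k) → ℕ) → ℕ → Vec ℕ k → ℕ
muScan f zero    xs = 0
muScan f (suc y) xs =
  ifz (muScan f y xs) (ifz (f (y ∷ xs)) 1 (ifz (pred (f (y ∷ xs))) (2 + y) 0)) (muScan f y xs)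

-- run e t xs is suc y if e yields y on xs with fuel t, and 0 if the fuel does not suffice.
run  : ∀ {k} → Code k → ℕ → Vec ℕ k → ℕ
runs : ∀ {k m} → Vec (Code k) m → ℕ → Vec ℕ k → Vec ℕ m
run zer         t xs       = 1
run succ        t (x ∷ []) = 2 + x
run (proj i)    t xs       = suc (lookup xs i)
run (comp f gs) t xs       = ifz (guard (runs gs t xs)) 0 (run f t (map pred (runs gs t xs)))
run (prec f g)  t (x ∷ xs) = precRun (run f t) (run g t) x xs
run (mu f)      t xs       = pred (muScan (run f t) t xs)
runs []       t xs = []
runs (g ∷ gs) t xs = run g t xs ∷ runs gs t xs

guardᴿ : ∀ {k m} {fs : Vec ℕ k → Vec ℕ m} → Recs fs → Rec (λ xs → guard (fs xs))
guardᴿ {fs = fs} r = go · r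
  where
  go : ∀ {m} → Rec {m} guard
  go {zero}  = Rec-≗ (λ { [] → refl }) (const 1)
  go {suc m} = Rec-≗ (λ { (x ∷ xs) → refl }) (ifzᴿ x₀ (const 0) (go · tailᴿ))

map-predᴿ : ∀ {k m} {fs : Vec ℕ k → Vec ℕ m} → Recs fs → Recs (λ xs → map pred (fs xs))
map-predᴿ r = go ·* r
  where
  go : ∀ {m} → Recs {m} (map pred)
  go {zero}  = recs [] λ { [] → [] }
  go {suc m} with (predᴿ x₀ ∷ᴿ (go {m} ·* tailᴿ))
  ... | recs es es↓ = recs es λ { (x ∷ xs) → es↓ (x ∷ xs) }

-- By recursion on the code, each e getting its own evaluator, recursive in the fuel and the
-- arguments.
runᴿ  : ∀ {k} (e : Code k) → Rec {suc k} (λ xs → run e (head xs) (tail xs))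
runsᴿ : ∀ {k m} (es : Vec (Code k) m) → Recs {suc k} (λ xs → runs es (head xs) (tail xs))
runᴿ zer         = const 1
runᴿ succ        = Rec-≗ (λ { (t ∷ x ∷ []) → refl }) (sucᴿ (sucᴿ x₁))
runᴿ (proj i)    = Rec-≗ (λ { (t ∷ xs) → refl }) (sucᴿ (arg (suc i)))
runᴿ (comp f gs) = Rec-≗ (λ { (t ∷ xs) → refl })
  (ifzᴿ (guardᴿ (runsᴿ gs)) (const 0) (runᴿ f · (x₀ ∷ᴿ map-predᴿ (runsᴿ gs))))
runᴿ (prec f g)  = Rec-≗ (λ { (t ∷ x ∷ xs) → refl })
  (primRec (λ x txs → precRun (run f (head txs)) (run g (head txs)) x (tail txs))
    (runᴿ f)
    (ifzᴿ x₁ (const 0) (runᴿ g · (x₂ ∷ᴿ x₀ ∷ᴿ predᴿ x₁ ∷ᴿ (tailᴿ ·* (tailᴿ ·* tailᴿ)))))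
    (λ _ → refl) (λ { x (t ∷ xs) → refl })
  · (x₁ ∷ᴿ x₀ ∷ᴿ (tailᴿ ·* tailᴿ)))
runᴿ (mu f)      = Rec-≗ (λ { (t ∷ xs) → refl })
  (predᴿ (primRec (λ y txs → muScan (run f (head txs)) y (tail txs))
    (const 0)
    (ifzᴿ x₁ (ifzᴿ step (const 1) (ifzᴿ (predᴿ step) (sucᴿ (sucᴿ x₀)) (const 0))) x₁)
    (λ _ → refl) (λ { y (t ∷ xs) → refl })
  · (x₀ ∷ᴿ x₀ ∷ᴿ tailᴿ)))
  where
  step = runᴿ f · (x₂ ∷ᴿ x₀ ∷ᴿ (tailᴿ ·* (tailᴿ ·* tailᴿ)))
runsᴿ []       = []ᴿ
runsᴿ (e ∷ es) = runᴿ e ∷ᴿ runsᴿ es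

guard-suc : ∀ {m} (ys : Vec ℕ m) → guard (map suc ys) ≡ 1
guard-suc []       = refl
guard-suc (y ∷ ys) = guard-suc ys

map-pred-suc : ∀ {m} (ys : Vec ℕ m) → map pred (map suc ys) ≡ ys
map-pred-suc []       = refl
map-pred-suc (y ∷ ys) = cong (y ∷_) (map-pred-suc ys)

run-sound  : ∀ {k} (e : Code k) t {xs y} → run e t xs ≡ suc y → e [ xs ]↓ y
runs-sound : ∀ {k m} (es : Vec (Code k) m) t {xs n} → guard (runs es t xs) ≡ suc n →
  Pointwise (λ g → g [ xs ]↓_) es (map pred (runs es t xs))
run-sound zer t refl = zer↓
run-sound succ t {x ∷ []} refl = succ↓
run-sound (proj i) t refl = proj↓ i
run-sound (comp f gs) t {xs} e≡ with guard (runs gs t xs) in g≡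
... | suc n = comp↓ (runs-sound gs t g≡) (run-sound f t e≡)
run-sound (prec f g) t {x ∷ xs} e≡ = go x e≡
  where
  go : ∀ x {y} → precRun (run f t) (run g t) x xs ≡ suc y → prec f g [ x ∷ xs ]↓ y
  go zero    e≡ = prec-zer↓ (run-sound f t e≡)
  go (suc x) e≡ with precRun (run f t) (run g t) x xs in r≡
  ... | suc r = prec-suc↓ (go x r≡) (run-sound g t e≡)
run-sound (mu f) t {xs} {y} e≡ with muScan (run f t) t xs in s≡
... | suc s with refl ← e≡ = found t s≡
  where
  searching : ∀ b → muScan (run f t) b xs ≡ 0 → ∀ z → z < b → ∃ λ w → f [ z ∷ xs ]↓ suc w
  searching (suc b) e≡ z z<1+b with muScan (run f t) b xs in s≡
  ... | zero with run f t (b ∷ xs) in r≡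
  ...   | suc (suc w) with m≤n⇒m<n∨m≡n (≤-pred z<1+b)
  ...     | inj₁ z<b  = searching b s≡ z z<b
  ...     | inj₂ refl = w , run-sound f t r≡
  searching (suc b) () z z<1+b | suc _
  found : ∀ b {y} → muScan (run f t) b xs ≡ suc (suc y) → mu f [ xs ]↓ y
  found (suc b) e≡ with muScan (run f t) b xs in s≡
  ... | suc _ = found b (trans s≡ e≡)
  ... | zero with run f t (b ∷ xs) in r≡
  found (suc b) refl | zero | suc zero = mu↓ (run-sound f t r≡) (searching b s≡)
runs-sound []       t e≡ = []
runs-sound (e ∷ es) t {xs} e≡ with run e t xs in r≡
... | suc y = run-sound e t r≡ ∷ runs-sound es t e≡

run-complete  : ∀ {k} {e : Code k} {xs y} → e [ xs ]↓ y → Eventually (λ t → run e t xs ≡ suc y)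
runs-complete : ∀ {k m} {es : Vec (Code k) m} {xs ys} → Pointwise (λ g → g [ xs ]↓_) es ys →
  Eventually (λ t → runs es t xs ≡ map suc ys)
run-complete zer↓      = 0 , λ _ _ → refl
run-complete succ↓     = 0 , λ _ _ → refl
run-complete (proj↓ i) = 0 , λ _ _ → refl
run-complete {xs = xs} (comp↓ {f = f} {gs = gs} {ys = ys} {y = y} gs↓ f↓) =
  eventually-map (λ {t} (p , q) → step t p q) (eventually-× (runs-complete gs↓) (run-complete f↓))
  where
  step : ∀ t → runs gs t xs ≡ map suc ys → run f t ys ≡ suc y → run (comp f gs) t xs ≡ suc y
  step t p q rewrite p | guard-suc ys | map-pred-suc ys = q
run-complete (prec-zer↓ f↓) = run-complete f↓
run-complete (prec-suc↓ {f = f} {g} {x} {xs} {r} {y} r↓ g↓) =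
  eventually-map (λ {t} (p , q) → step t p q) (eventually-× (run-complete r↓) (run-complete g↓))
  where
  step : ∀ t → run (prec f g) t (x ∷ xs) ≡ suc r → run g t (x ∷ r ∷ xs) ≡ suc y →
    run (prec f g) t (suc x ∷ xs) ≡ suc y
  step t p q rewrite p = q
run-complete (mu↓ {f = f} {xs} {y} f↓ lt) =
  eventually-map (λ {t} (p , q , r) → step t p q r)
    -- With fuel t the scan reaches only arguments below t, so t has to exceed the value y.
    (eventually-× (suc y , λ _ le → le)
      (eventually-× (run-complete f↓) (eventually-∀< y below)))
  where
  below : ∀ z → z < y → Eventually (λ t → ∃ λ w → run f t (z ∷ xs) ≡ suc (suc w))
  below z z<y with lt z z<y
  ... | w , d = eventually-map (λ e≡ → w , e≡) (run-complete d)
  step : ∀ t → y < t → run f t (y ∷ xs) ≡ 1 →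
    (∀ z → z < y → ∃ λ w → run f t (z ∷ xs) ≡ suc (suc w)) → run (mu f) t xs ≡ suc y
  step t y<t at-y below-y = cong pred (found t y<t)
    where
    searching : ∀ b → b ≤ y → muScan (run f t) b xs ≡ 0
    searching zero    _   = refl
    searching (suc b) b<y with below-y b b<y
    ... | w , e≡ rewrite searching b (<⇒≤ b<y) | e≡ = refl
    found : ∀ b → y < b → muScan (run f t) b xs ≡ suc (suc y)
    found (suc b) y<1+b with m≤n⇒m<n∨m≡n (≤-pred y<1+b)
    ... | inj₁ y<b rewrite found b y<b = refl
    ... | inj₂ refl rewrite searching b ≤-refl | at-y = refl
runs-complete []         = 0 , λ _ _ → refl
runs-complete (d ∷ ds) =
  eventually-map (λ (p , q) → cong₂ _∷_ p q) (eventually-× (run-complete d) (runs-complete ds))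

-- Pairing, lists and course-of-values recursion

-- root n is the index of the diagonal on which n lies.
root : ℕ → ℕ
root zero    = 0
root (suc n) = root n + (1 ∸ (triangle (suc (root n)) ∸ suc n))

-- The increment in `root` is 1 exactly when the next number begins a new diagonal. As `pair x y` is
-- the entry y of diagonal x + y, this inverts the pairing.
root-triangle : ∀ s y → y ≤ s → root (triangle s + y) ≡ s
root-triangle zero    zero    _   = refl
root-triangle (suc s) zero    _   = begin
  root (suc s + triangle s + 0)                       ≡⟨ cong root (+-identityʳ (suc s + triangle s)) ⟩
  root (suc (s + triangle s))                         ≡⟨ cong (λ n → root (suc n)) (+-comm s (triangle s)) ⟩
  root (suc n)                                        ≡⟨ cong (λ r → r + (1 ∸ (triangle (suc r) ∸ suc n))) (root-triangle s s ≤-refl) ⟩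
  s + (1 ∸ (suc (s + triangle s) ∸ suc n))            ≡⟨ cong (λ m → s + (1 ∸ (m ∸ n))) (+-comm s (triangle s)) ⟩
  s + (1 ∸ (n ∸ n))                                   ≡⟨ cong (λ m → s + (1 ∸ m)) (n∸n≡0 n) ⟩
  s + 1                                               ≡⟨ +-comm s 1 ⟩
  suc s                                               ∎
  where
  open ≡-Reasoning
  n = triangle s + s
root-triangle s       (suc y) y<s = begin
  root (triangle s + suc y)                           ≡⟨ cong root (+-suc (triangle s) y) ⟩
  root (suc n)                                        ≡⟨ cong (λ r → r + (1 ∸ (triangle (suc r) ∸ suc n))) (root-triangle s y (<⇒≤ y<s)) ⟩
  s + (1 ∸ (s + triangle s ∸ n))                      ≡⟨ cong (λ m → s + (1 ∸ (m ∸ n))) (+-comm s (triangle s)) ⟩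
  s + (1 ∸ (triangle s + s ∸ (triangle s + y)))       ≡⟨ cong (λ m → s + (1 ∸ m)) ([m+n]∸[m+o]≡n∸o (triangle s) s y) ⟩
  s + (1 ∸ (s ∸ y))                                   ≡⟨ cong (s +_) (m≤n⇒m∸n≡0 (m<n⇒0<n∸m y<s)) ⟩
  s + 0                                               ≡⟨ +-identityʳ s ⟩
  s                                                   ∎
  where
  open ≡-Reasoning
  n = triangle s + y

n≤triangle : ∀ n → n ≤ triangle n
n≤triangle zero    = z≤n
n≤triangle (suc n) = m≤m+n (suc n) (triangle n)

-- Kept opaque so that codes of formulas never unfold into the arithmetic of the pairing; `cons-def`
-- is the only link to `encode`.
abstract
  cons : ℕ → ℕ → ℕ
  cons a b = suc (pair a b)

  tl hd : ℕ → ℕ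
  tl n = pred n ∸ triangle (root (pred n))
  hd n = root (pred n) ∸ tl n

  cons-def : ∀ a b → suc (pair a b) ≡ cons a b
  cons-def a b = refl

  cons≢0 : ∀ {a b} → cons a b ≢ 0
  cons≢0 ()

  tl-cons : ∀ a b → tl (cons a b) ≡ b
  tl-cons a b = trans
    (cong (λ s → triangle (a + b) + b ∸ triangle s) (root-triangle (a + b) b (m≤n+m b a)))
    (m+n∸m≡n (triangle (a + b)) b)

  hd-cons : ∀ a b → hd (cons a b) ≡ a
  hd-cons a b = trans
    (cong₂ _∸_ (root-triangle (a + b) b (m≤n+m b a)) (tl-cons a b)) (m+n∸n≡m a b)

  hd-0 : hd 0 ≡ 0
  hd-0 = refl

  tl-0 : tl 0 ≡ 0
  tl-0 = refl

  <cons₁ : ∀ a b → a < cons a b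
  <cons₁ a b = s≤s (≤-trans (m≤m+n a b) (≤-trans (n≤triangle (a + b)) (m≤m+n _ b)))

  <cons₂ : ∀ a b → b < cons a b
  <cons₂ a b = s≤s (m≤n+m b _)

  -- Tells a term code at the head of a list of arguments from a term tag, which is at most 2.
  3≤cons-cons : ∀ a b c → 3 ≤ cons a (cons b c)
  3≤cons-cons a b c = s≤s (+-mono-≤ {1} {_} {1}
    (≤-trans (s≤s z≤n) (≤-trans (m≤n+m (suc (pair b c)) a) (n≤triangle _))) (s≤s z≤n))

  consᴿ : ∀ {k f g} → Rec {k} f → Rec g → Rec (λ xs → cons (f xs) (g xs))
  consᴿ r s = sucᴿ (pairᴿ · (r ∷ᴿ s ∷ᴿ []ᴿ))
    where
    pairᴿ : Rec {2} λ xs → pair (head xs) (head (tail xs))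
    pairᴿ = rec pairC λ { (x ∷ y ∷ []) → pairC↓ x y }

  private
    triangleᴿ : ∀ {k f} → Rec {k} f → Rec (λ xs → triangle (f xs))
    triangleᴿ r = triᴿ · (r ∷ᴿ []ᴿ)
      where
      triᴿ : Rec {1} λ xs → triangle (head xs)
      triᴿ = rec triangleC λ { (x ∷ []) → triangleC↓ x }

    rootᴿ : ∀ {k f} → Rec {k} f → Rec (λ xs → root (f xs))
    rootᴿ r = primRec (λ n _ → root n) (const {0} 0)
      (x₁ +ᴿ (const 1 ∸ᴿ (triangleᴿ (sucᴿ x₁) ∸ᴿ sucᴿ x₀))) (λ _ → refl) (λ _ _ → refl) · (r ∷ᴿ []ᴿ)

  tlᴿ : ∀ {k f} → Rec {k} f → Rec (λ xs → tl (f xs))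
  tlᴿ r = predᴿ r ∸ᴿ triangleᴿ (rootᴿ (predᴿ r))

  hdᴿ : ∀ {k f} → Rec {k} f → Rec (λ xs → hd (f xs))
  hdᴿ r = rootᴿ (predᴿ r) ∸ᴿ tlᴿ r

  ifz-cons : ∀ a b {x y} → ifz (cons a b) x y ≡ y
  ifz-cons a b = refl

ifz-0 : ∀ {n x y} → n ≡ 0 → ifz n x y ≡ x
ifz-0 refl = refl

drop : ℕ → ℕ → ℕ
drop zero    l = l
drop (suc k) l = tl (drop k l)

dropᴿ : ∀ {k f g} → Rec {k} f → Rec g → Rec (λ xs → drop (f xs) (g xs))
dropᴿ r s = primRec (λ n xs → drop n (lookup xs zero)) x₀ (tlᴿ x₁) (λ _ → refl) (λ _ _ → refl)
  · (r ∷ᴿ s ∷ᴿ []ᴿ)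

drop-cons : ∀ k a b → drop (suc k) (cons a b) ≡ drop k b
drop-cons zero    a b = tl-cons a b
drop-cons (suc k) a b = cong tl (drop-cons k a b)

nth : ℕ → ℕ → ℕ
nth k l = hd (drop k l)

nthᴿ : ∀ {k f g} → Rec {k} f → Rec g → Rec (λ xs → nth (f xs) (g xs))
nthᴿ r s = hdᴿ (dropᴿ r s)

encode-∷ : ∀ {k} x (xs : Vec ℕ k) → encode (x ∷ xs) ≡ cons x (encode xs)
encode-∷ x xs = cons-def x (encode xs)

nth-encode : ∀ {k} i (xs : Vec ℕ k) → nth (toℕ i) (encode xs) ≡ lookup xs i
nth-encode zero    (x ∷ xs) = trans (cong hd (encode-∷ x xs)) (hd-cons x _)
nth-encode (suc i) (x ∷ xs) = trans
  (cong hd (trans (cong (drop (suc (toℕ i))) (encode-∷ x xs)) (drop-cons (toℕ i) x _)))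
  (nth-encode i xs)

encodeᴿ : ∀ {k m} {fs : Vec ℕ k → Vec ℕ m} → Recs fs → Rec (λ xs → encode (fs xs))
encodeᴿ (recs es es↓) = rec (encodeC es) λ xs → encodeC↓ (es↓ xs)

-- Course-of-values recursion along the lists coded by cons: node receives an argument n,
-- its head and tail, the table of all previous values and the parameters.
module _ {k} (node : Vec ℕ (4 + k) → ℕ) where

  table : ℕ → Vec ℕ k → ℕ
  table zero    ps = 0
  table (suc n) ps = cons (node (n ∷ hd n ∷ tl n ∷ table n ps ∷ ps)) (table n ps)

  nodeRec : ℕ → Vec ℕ k → ℕ
  nodeRec n ps = node (n ∷ hd n ∷ tl n ∷ table n ps ∷ ps)

  nodeRec-cons : ∀ a b ps →
    nodeRec (cons a b) ps ≡ node (cons a b ∷ a ∷ b ∷ table (cons a b) ps ∷ ps)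
  nodeRec-cons a b ps =
    cong₂ (λ x y → node (cons a b ∷ x ∷ y ∷ table (cons a b) ps ∷ ps)) (hd-cons a b) (tl-cons a b)

  drop-table : ∀ n j ps → drop j (table n ps) ≡ table (n ∸ j) ps
  drop-table n zero    ps = refl
  drop-table n (suc j) ps = begin
    tl (drop j (table n ps)) ≡⟨ cong tl (drop-table n j ps) ⟩
    tl (table (n ∸ j) ps)    ≡⟨ tl-table (n ∸ j) ⟩
    table (pred (n ∸ j)) ps  ≡⟨ cong (λ m → table m ps) (pred[m∸n]≡m∸[1+n] n j) ⟩
    table (n ∸ suc j) ps     ∎
    where
    open ≡-Reasoning
    tl-table : ∀ n → tl (table n ps) ≡ table (pred n) ps
    tl-table zero    = tl-0
    tl-table (suc n) = tl-cons _ _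

-- The table lists the values at n - 1 down to 0, so the value at j has position n - 1 - j.
previous : ℕ → ℕ → ℕ → ℕ
previous n l j = nth (n ∸ suc j) l

previousᴿ : ∀ {k f g h} → Rec {k} f → Rec g → Rec h → Rec (λ xs → previous (f xs) (g xs) (h xs))
previousᴿ r s t = nthᴿ (r ∸ᴿ sucᴿ t) s

previous-table : ∀ {k} (node : Vec ℕ (4 + k) → ℕ) {n j} ps → j < n →
  previous n (table node n ps) j ≡ nodeRec node j ps
previous-table node {n} {j} ps j<n = begin
  hd (drop (n ∸ suc j) (table node n ps))  ≡⟨ cong hd (drop-table node n (n ∸ suc j) ps) ⟩
  hd (table node (n ∸ (n ∸ suc j)) ps)     ≡⟨ cong (λ m → hd (table node m ps)) (m∸[m∸n]≡n j<n) ⟩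
  hd (table node (suc j) ps)               ≡⟨ hd-cons _ _ ⟩
  nodeRec node j ps                        ∎
  where open ≡-Reasoning

nodeRecᴿ : ∀ {k l node} {f : Vec ℕ l → ℕ} {ps : Vec ℕ l → Vec ℕ k} →
  Rec node → Rec f → Recs ps → Rec (λ xs → nodeRec node (f xs) (ps xs))
nodeRecᴿ {node = node} nodeᴿ r psᴿ =
  nodeᴿ · (r ∷ᴿ hdᴿ r ∷ᴿ tlᴿ r ∷ᴿ (tableᴿ · (r ∷ᴿ psᴿ)) ∷ᴿ psᴿ)
  where
  tableᴿ = primRec (table node) (const 0)
    (consᴿ (nodeᴿ · (x₀ ∷ᴿ hdᴿ x₀ ∷ᴿ tlᴿ x₀ ∷ᴿ x₁ ∷ᴿ (tailᴿ ·* tailᴿ))) x₁)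
    (λ _ → refl) (λ _ _ → refl)

-- Quantifier prefixes of codes

-- Tags above 4 are those of the quantifiers.
depthNode : Vec ℕ 4 → ℕ
depthNode (n ∷ a ∷ b ∷ l ∷ []) = ifz (a ∸ 4) 0 (suc (previous n l (hd b)))

-- For a prenex formula this is the length of the prefix, hence the number of bound variables that
-- its matrix may contain.
depth : ℕ → ℕ
depth n = nodeRec depthNode n []

depthᴿ : ∀ {k f} → Rec {k} f → Rec (λ xs → depth (f xs))
depthᴿ r = nodeRecᴿ depthNodeᴿ r []ᴿ
  where
  depthNodeᴿ : Rec depthNode
  depthNodeᴿ = Rec-≗ (λ { (n ∷ a ∷ b ∷ l ∷ []) → refl })
    (ifzᴿ (x₁ ∸ᴿ const 4) (const 0) (sucᴿ (previousᴿ x₀ x₃ (hdᴿ x₂))))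

depth-qf : ∀ a b → a ∸ 4 ≡ 0 → depth (cons a b) ≡ 0
depth-qf a b a≤4 = trans (nodeRec-cons depthNode a b []) (ifz-0 a≤4)

depth-quantifier : ∀ a c l → depth (cons (5 + a) (cons c l)) ≡ suc (depth c)
depth-quantifier a c l = trans (nodeRec-cons depthNode (5 + a) (cons c l) [])
  (cong suc (trans (cong (previous n (table depthNode n [])) (hd-cons c l))
    (previous-table depthNode [] (<-trans (<cons₁ c l) (<cons₂ _ _)))))
  where n = cons (5 + a) (cons c l)

-- The tag of `∃′_` is 5, and the first argument of `ifz` is the distance of the tag from 5. All
-- other codes are sent to 0, which codes no formula, so that stripping too often can be detected.
matrix : ℕ → ℕ
matrix n = ifz ((5 ∸ hd n) + (hd n ∸ 5)) (hd (tl n)) 0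

strip : ℕ → ℕ → ℕ
strip zero    n = n
strip (suc k) n = matrix (strip k n)

stripᴿ : ∀ {k f g} → Rec {k} f → Rec g → Rec (λ xs → strip (f xs) (g xs))
stripᴿ r s = primRec (λ k xs → strip k (lookup xs zero)) x₀
    (ifzᴿ ((const 5 ∸ᴿ hdᴿ x₁) +ᴿ (hdᴿ x₁ ∸ᴿ const 5)) (hdᴿ (tlᴿ x₁)) (const 0))
    (λ _ → refl) (λ _ _ → refl) · (r ∷ᴿ s ∷ᴿ []ᴿ)

strip-matrix : ∀ k n → strip (suc k) n ≡ strip k (matrix n)
strip-matrix zero    n = refl
strip-matrix (suc k) n = cong matrix (strip-matrix k n)

matrix-∃ : ∀ c l → matrix (cons 5 (cons c l)) ≡ c
matrix-∃ c l = trans (ifz-0 (cong (λ a → (5 ∸ a) + (a ∸ 5)) (hd-cons 5 _)))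
  (trans (cong hd (tl-cons 5 _)) (hd-cons c l))

matrix-other : ∀ n → hd n ≢ 5 → matrix n ≡ 0
matrix-other n ≢5 with hd n
... | 0 = refl
... | 1 = refl
... | 2 = refl
... | 3 = refl
... | 4 = refl
... | 5 = ⊥-elim (≢5 refl)
... | suc (suc (suc (suc (suc (suc _))))) = refl

strip-0 : ∀ k → strip k 0 ≡ 0
strip-0 zero    = refl
strip-0 (suc k) = trans (cong matrix (strip-0 k)) (matrix-other 0 (λ p → 0≢1+n (trans (sym hd-0) p)))

-- Substitution in codes: par t ℓ i is the successor of the value of the parameter with index ℓ
-- in the i-th structure, or 0 if fuel t does not suffice to compute it.  The variables
-- beyond the first d are replaced by the elements listed in ρ.
module Substitution (par : ℕ → ℕ → ℕ → ℕ)
  (parᴿ : Rec {3} (λ xs → par (lookup xs zero) (lookup xs (suc zero)) (lookup xs (suc (suc zero))))) where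

  termNode : Vec ℕ 8 → ℕ
  termNode (n ∷ a ∷ b ∷ l ∷ d ∷ ρ ∷ t ∷ i ∷ []) =
    ifz n 0
    -- The difference is 0 exactly for the variables below d, which are bound and stay in place.
    (ifz a (ifz (suc (hd b) ∸ d) n (cons 1 (cons (nth (hd b ∸ d) ρ) 0)))
    (ifz (a ∸ 1) (cons 1 (cons (pred (par t (hd b) i)) 0))
    (ifz (a ∸ 2) (cons 2 (cons (hd b) (previous n l (tl b))))
    (cons (previous n l a) (previous n l b)))))

  private
    x₆ : ∀ {k} → Rec {7 + k} (λ xs → lookup xs (suc (suc (suc (suc (suc (suc zero)))))))
    x₆ = arg _
    x₇ : ∀ {k} → Rec {8 + k} (λ xs → lookup xs (suc (suc (suc (suc (suc (suc (suc zero))))))))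
    x₇ = arg _

  -- The code of a term and the list of the codes of several terms are treated alike: the
  -- head of the former is less than 3, the head of the latter is not.
  substTerm : ℕ → Vec ℕ 4 → ℕ
  substTerm = nodeRec termNode

  termNodeᴿ : Rec termNode
  termNodeᴿ = Rec-≗ (λ { (n ∷ a ∷ b ∷ l ∷ d ∷ ρ ∷ t ∷ i ∷ []) → refl })
    (ifzᴿ x₀ (const 0)
    (ifzᴿ x₁ (ifzᴿ (sucᴿ (hdᴿ x₂) ∸ᴿ x₄) x₀ (consᴿ (const 1) (consᴿ (nthᴿ (hdᴿ x₂ ∸ᴿ x₄) x₅) (const 0))))
    (ifzᴿ (x₁ ∸ᴿ const 1) (consᴿ (const 1) (consᴿ (predᴿ (parᴿ · (x₆ ∷ᴿ hdᴿ x₂ ∷ᴿ x₇ ∷ᴿ []ᴿ))) (const 0)))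
    (ifzᴿ (x₁ ∸ᴿ const 2) (consᴿ (const 2) (consᴿ (hdᴿ x₂) (previousᴿ x₀ x₃ (tlᴿ x₂))))
    (consᴿ (previousᴿ x₀ x₃ x₁) (previousᴿ x₀ x₃ x₂))))))

  qfNode : Vec ℕ 8 → ℕ
  qfNode (n ∷ a ∷ b ∷ l ∷ ps) =
    ifz a (cons 0 (substTerm b ps))
    (ifz (a ∸ 1) (cons 1 (cons (hd b) (substTerm (tl b) ps)))
    (ifz (a ∸ 2) (cons 2 (cons (previous n l (hd b)) 0))
    (cons a (cons (previous n l (hd b)) (cons (previous n l (hd (tl b))) 0)))))

  substQF : ℕ → Vec ℕ 4 → ℕ
  substQF = nodeRec qfNode

  params : Recs {8} (λ xs → tail (tail (tail (tail xs))))
  params = tailᴿ ·* (tailᴿ ·* (tailᴿ ·* tailᴿ))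

  qfNodeᴿ : Rec qfNode
  qfNodeᴿ = Rec-≗ (λ { (n ∷ a ∷ b ∷ l ∷ ps) → refl })
    (ifzᴿ x₁ (consᴿ (const 0) (nodeRecᴿ termNodeᴿ x₂ params))
    (ifzᴿ (x₁ ∸ᴿ const 1) (consᴿ (const 1) (consᴿ (hdᴿ x₂) (nodeRecᴿ termNodeᴿ (tlᴿ x₂) params)))
    (ifzᴿ (x₁ ∸ᴿ const 2) (consᴿ (const 2) (consᴿ (previousᴿ x₀ x₃ (hdᴿ x₂)) (const 0)))
    (consᴿ x₁ (consᴿ (previousᴿ x₀ x₃ (hdᴿ x₂)) (consᴿ (previousᴿ x₀ x₃ (hdᴿ (tlᴿ x₂))) (const 0)))))))

  -- Terms occur only in the matrix, below all quantifiers. So d need not change during the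
  -- recursion: it is the length of the entire prefix from the start.
  dualNode : Vec ℕ 8 → ℕ
  dualNode (n ∷ a ∷ b ∷ l ∷ ps) =
    ifz (a ∸ 4) (cons 2 (cons (substQF n ps) 0))
    (ifz (a ∸ 5) (cons 6 (cons (previous n l (hd b)) 0)) (cons 5 (cons (previous n l (hd b)) 0)))

  -- Substitution in the negation of a prenex formula, brought to prenex form.
  substDual : ℕ → Vec ℕ 4 → ℕ
  substDual = nodeRec dualNode

  dualNodeᴿ : Rec dualNode
  dualNodeᴿ = Rec-≗ (λ { (n ∷ a ∷ b ∷ l ∷ ps) → refl })
    (ifzᴿ (x₁ ∸ᴿ const 4) (consᴿ (const 2) (consᴿ (nodeRecᴿ qfNodeᴿ x₀ params) (const 0)))
    (ifzᴿ (x₁ ∸ᴿ const 5) (consᴿ (const 6) (consᴿ (previousᴿ x₀ x₃ (hdᴿ x₂)) (const 0)))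
      (consᴿ (const 5) (consᴿ (previousᴿ x₀ x₃ (hdᴿ x₂)) (const 0)))))

  substDualᴿ : ∀ {l} {f : Vec ℕ l → ℕ} {ps : Vec ℕ l → Vec ℕ 4} →
    Rec f → Recs ps → Rec (λ xs → substDual (f xs) (ps xs))
  substDualᴿ = nodeRecᴿ dualNodeᴿ

  module _ (d ρ t i : ℕ) where
    private
      ps : Vec ℕ 4
      ps = d ∷ ρ ∷ t ∷ i ∷ []
      U G D : ℕ → ℕ
      U n = substTerm n ps
      G n = substQF n ps
      D n = substDual n ps

      U-cons : ∀ a b → U (cons a b) ≡ ifz a _ _
      U-cons a b = trans (nodeRec-cons termNode a b ps) (ifz-cons a b)

    substTerm-bound : ∀ v → v < d → U (cons 0 (cons v 0)) ≡ cons 0 (cons v 0)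
    substTerm-bound v v<d = trans (U-cons 0 (cons v 0))
      (ifz-0 (trans (cong (λ m → suc m ∸ d) (hd-cons v 0)) (m≤n⇒m∸n≡0 v<d)))

    substTerm-free : ∀ v → U (cons 0 (cons (d + v) 0)) ≡ cons 1 (cons (nth v ρ) 0)
    substTerm-free v = trans (U-cons 0 (cons (d + v) 0))
      (cong₂ (λ m n → ifz m (cons 0 (cons (d + v) 0)) (cons 1 (cons (nth n ρ) 0)))
        (trans (cong (λ m → suc m ∸ d) (hd-cons (d + v) 0))
          (trans (cong (_∸ d) (sym (+-suc d v))) (m+n∸m≡n d (suc v))))
        (trans (cong (_∸ d) (hd-cons (d + v) 0)) (m+n∸m≡n d v)))

    substTerm-par : ∀ ℓ → U (cons 1 (cons ℓ 0)) ≡ cons 1 (cons (pred (par t ℓ i)) 0)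
    substTerm-par ℓ = trans (U-cons 1 (cons ℓ 0))
      (cong (λ m → cons 1 (cons (pred (par t m i)) 0)) (hd-cons ℓ 0))

    substTerm-app : ∀ f l → U (cons 2 (cons f l)) ≡ cons 2 (cons f (U l))
    substTerm-app f l = trans (U-cons 2 (cons f l))
      (cong (cons 2) (cong₂ cons (hd-cons f l)
        (trans (cong (previous n (table termNode n ps)) (tl-cons f l))
          (previous-table termNode ps (<-trans (<cons₂ f l) (<cons₂ _ _))))))
      where n = cons 2 (cons f l)

    substTerm-[] : U 0 ≡ 0
    substTerm-[] = refl

    substTerm-∷ : ∀ a b → 3 ≤ a → U (cons a b) ≡ cons (U a) (U b)
    substTerm-∷ a@(suc (suc (suc a′))) b (s≤s (s≤s (s≤s _))) = trans (U-cons a b)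
      (cong₂ cons (previous-table termNode ps (<cons₁ a b)) (previous-table termNode ps (<cons₂ a b)))

    substQF-eq : ∀ b → G (cons 0 b) ≡ cons 0 (U b)
    substQF-eq b = nodeRec-cons qfNode 0 b ps

    substQF-atom : ∀ r l → G (cons 1 (cons r l)) ≡ cons 1 (cons r (U l))
    substQF-atom r l = trans (nodeRec-cons qfNode 1 (cons r l) ps)
      (cong (cons 1) (cong₂ cons (hd-cons r l) (cong U (tl-cons r l))))

    substQF-¬ : ∀ c → G (cons 2 (cons c 0)) ≡ cons 2 (cons (G c) 0)
    substQF-¬ c = trans (nodeRec-cons qfNode 2 (cons c 0) ps)
      (cong (λ m → cons 2 (cons m 0)) (trans (cong (previous n (table qfNode n ps)) (hd-cons c 0))
        (previous-table qfNode ps (<-trans (<cons₁ c 0) (<cons₂ _ _)))))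
      where n = cons 2 (cons c 0)

    substQF-binary : ∀ a c e → G (cons (3 + a) (cons c (cons e 0))) ≡ cons (3 + a) (cons (G c) (cons (G e) 0))
    substQF-binary a c e = trans (nodeRec-cons qfNode (3 + a) (cons c (cons e 0)) ps)
      (cong₂ (λ x y → cons (3 + a) (cons x (cons y 0)))
        (trans (cong (previous n (table qfNode n ps)) (hd-cons c (cons e 0)))
          (previous-table qfNode ps (<-trans (<cons₁ c (cons e 0)) (<cons₂ _ _))))
        (trans (cong (previous n (table qfNode n ps)) (trans (cong hd (tl-cons c (cons e 0))) (hd-cons e 0)))
          (previous-table qfNode ps (<-trans (<cons₁ e 0) (<-trans (<cons₂ c _) (<cons₂ _ _))))))
      where n = cons (3 + a) (cons c (cons e 0))

    substDual-qf : ∀ a b → a ∸ 4 ≡ 0 → D (cons a b) ≡ cons 2 (cons (G (cons a b)) 0)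
    substDual-qf a b a≤4 = trans (nodeRec-cons dualNode a b ps) (ifz-0 a≤4)

    substDual-∃ : ∀ c → D (cons 5 (cons c 0)) ≡ cons 6 (cons (D c) 0)
    substDual-∃ c = trans (nodeRec-cons dualNode 5 (cons c 0) ps)
      (cong (λ m → cons 6 (cons m 0)) (trans (cong (previous n (table dualNode n ps)) (hd-cons c 0))
        (previous-table dualNode ps (<-trans (<cons₁ c 0) (<cons₂ _ _)))))
      where n = cons 5 (cons c 0)

    substDual-∀ : ∀ c → D (cons 6 (cons c 0)) ≡ cons 5 (cons (D c) 0)
    substDual-∀ c = trans (nodeRec-cons dualNode 6 (cons c 0) ps)
      (cong (λ m → cons 5 (cons m 0)) (trans (cong (previous n (table dualNode n ps)) (hd-cons c 0))
        (previous-table dualNode ps (<-trans (<cons₁ c 0) (<cons₂ _ _)))))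
      where n = cons 6 (cons c 0)

-- Formulas and their codes

encode-injective : ∀ {k l} x (xs : Vec ℕ k) y (ys : Vec ℕ l) →
  encode (x ∷ xs) ≡ encode (y ∷ ys) → x ≡ y × encode xs ≡ encode ys
encode-injective x xs y ys e =
  trans (sym (hd-cons x _)) (trans (cong hd e′) (hd-cons y _)) ,
  trans (sym (tl-cons x _)) (trans (cong tl e′) (tl-cons y _))
  where
  e′ : cons x (encode xs) ≡ cons y (encode ys)
  e′ = trans (sym (encode-∷ x xs)) (trans e (encode-∷ y ys))

encode₂ : ∀ {k} x y (zs : Vec ℕ k) → encode (x ∷ y ∷ zs) ≡ cons x (cons y (encode zs))
encode₂ x y zs = trans (encode-∷ x (y ∷ zs)) (cong (cons x) (encode-∷ y zs))

encode₃ : ∀ {k} x y z (zs : Vec ℕ k) → encode (x ∷ y ∷ z ∷ zs) ≡ cons x (cons y (cons z (encode zs)))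
encode₃ x y z zs = trans (encode-∷ x (y ∷ z ∷ zs)) (cong (cons x) (encode₂ y z zs))

module _ {L : Language} {P : Set} {index : P → ℕ} (index-injective : Injective _≡_ _≡_ index) where

  private
    termTag : ∀ {m} → Term L P m → ℕ
    termTag (var _)   = 0
    termTag (par _)   = 1
    termTag (app _ _) = 2

    formulaTag : ∀ {m} → Formula L P m → ℕ
    formulaTag (eq _ _)   = 0
    formulaTag (atom _ _) = 1
    formulaTag (¬′ _)     = 2
    formulaTag (_ ∧′ _)   = 3
    formulaTag (_ ∨′ _)   = 4
    formulaTag (∃′ _)     = 5
    formulaTag (∀′ _)     = 6

    hd-codeTerm : ∀ {m} (t : Term L P m) → hd (codeTerm index t) ≡ termTag t
    hd-codeTerm (var x)    = trans (cong hd (encode-∷ 0 (toℕ x ∷ []))) (hd-cons _ _)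
    hd-codeTerm (par q)    = trans (cong hd (encode-∷ 1 (index q ∷ []))) (hd-cons _ _)
    hd-codeTerm (app f ts) = trans (cong hd (encode-∷ 2 (proj₁ f ∷ codeTerms index ts))) (hd-cons _ _)

    hd-codeFormula : ∀ {m} (Φ : Formula L P m) → hd (codeFormula index Φ) ≡ formulaTag Φ
    hd-codeFormula (eq t u)    = trans (cong hd (encode-∷ 0 (codeTerm index t ∷ codeTerm index u ∷ []))) (hd-cons _ _)
    hd-codeFormula (atom r ts) = trans (cong hd (encode-∷ 1 (proj₁ r ∷ codeTerms index ts))) (hd-cons _ _)
    hd-codeFormula (¬′ Φ)      = trans (cong hd (encode-∷ 2 (codeFormula index Φ ∷ []))) (hd-cons _ _)
    hd-codeFormula (Φ ∧′ Ψ)    = trans (cong hd (encode-∷ 3 (codeFormula index Φ ∷ codeFormula index Ψ ∷ []))) (hd-cons _ _)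
    hd-codeFormula (Φ ∨′ Ψ)    = trans (cong hd (encode-∷ 4 (codeFormula index Φ ∷ codeFormula index Ψ ∷ []))) (hd-cons _ _)
    hd-codeFormula (∃′ Φ)      = trans (cong hd (encode-∷ 5 (codeFormula index Φ ∷ []))) (hd-cons _ _)
    hd-codeFormula (∀′ Φ)      = trans (cong hd (encode-∷ 6 (codeFormula index Φ ∷ []))) (hd-cons _ _)

    tails : ∀ {k l} x (xs : Vec ℕ k) y (ys : Vec ℕ l) →
      encode (x ∷ xs) ≡ encode (y ∷ ys) → encode xs ≡ encode ys
    tails x xs y ys e = proj₂ (encode-injective x xs y ys e)

    symbol : ∀ {p : ℕ → Bool} {a b : ∃ λ s → T (p s)} → proj₁ a ≡ proj₁ b → a ≡ b
    symbol {a = _ , p} {_ , q} refl = cong (_ ,_) (T-irrelevant p q)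

  codeTerm-injective  : ∀ {m} (t u : Term L P m) → codeTerm index t ≡ codeTerm index u → t ≡ u
  codeTerms-injective : ∀ {m k} (ts us : Vec (Term L P m) k) →
    encode (codeTerms index ts) ≡ encode (codeTerms index us) → ts ≡ us
  private
    -- Matching on the equality of the tags discards all pairs with different outermost
    -- constructors.
    sameTerm : ∀ {m} (t u : Term L P m) → termTag t ≡ termTag u →
      codeTerm index t ≡ codeTerm index u → t ≡ u
  codeTerm-injective t u e =
    sameTerm t u (trans (sym (hd-codeTerm t)) (trans (cong hd e) (hd-codeTerm u))) e
  codeTerms-injective []       []       e = refl
  codeTerms-injective (t ∷ ts) (u ∷ us) e =
    let e₁ , e₂ = encode-injective (codeTerm index t) (codeTerms index ts) (codeTerm index u) (codeTerms index us) e
    in cong₂ _∷_ (codeTerm-injective t u e₁) (codeTerms-injective ts us e₂)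
  sameTerm (var x) (var y) refl e =
    cong var (toℕ-injective (proj₁ (encode-injective (toℕ x) [] (toℕ y) [] (tails 0 (toℕ x ∷ []) 0 (toℕ y ∷ []) e))))
  sameTerm (par p) (par q) refl e =
    cong par (index-injective (proj₁ (encode-injective (index p) [] (index q) [] (tails 1 (index p ∷ []) 1 (index q ∷ []) e))))
  sameTerm (app f ts) (app g us) refl e
    with e₁ , e₂ ← encode-injective (proj₁ f) (codeTerms index ts) (proj₁ g) (codeTerms index us)
           (tails 2 (proj₁ f ∷ codeTerms index ts) 2 (proj₁ g ∷ codeTerms index us) e)
    with refl ← symbol {a = f} {g} e₁
    = cong (app f) (codeTerms-injective ts us e₂)

  -- Membership in a set of codes such as `ΣDiagram` provides only some formula with the given code;
  -- injectivity identifies it with the intended one.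
  codeFormula-injective : ∀ {m} (Φ Ψ : Formula L P m) → codeFormula index Φ ≡ codeFormula index Ψ → Φ ≡ Ψ
  private
    sameFormula : ∀ {m} (Φ Ψ : Formula L P m) → formulaTag Φ ≡ formulaTag Ψ →
      codeFormula index Φ ≡ codeFormula index Ψ → Φ ≡ Ψ
    arguments : ∀ a b c d e f → encode (a ∷ b ∷ c ∷ []) ≡ encode (d ∷ e ∷ f ∷ []) → b ≡ e × c ≡ f
    arguments a b c d e f p =
      let p₁ , p₂ = encode-injective b (c ∷ []) e (f ∷ []) (tails a (b ∷ c ∷ []) d (e ∷ f ∷ []) p)
      in p₁ , proj₁ (encode-injective c [] f [] p₂)
    argument : ∀ a b d e → encode (a ∷ b ∷ []) ≡ encode (d ∷ e ∷ []) → b ≡ e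
    argument a b d e p = proj₁ (encode-injective b [] e [] (tails a (b ∷ []) d (e ∷ []) p))
  codeFormula-injective Φ Ψ e =
    sameFormula Φ Ψ (trans (sym (hd-codeFormula Φ)) (trans (cong hd e) (hd-codeFormula Ψ))) e
  sameFormula (eq t u) (eq v w) refl e =
    let e₁ , e₂ = arguments 0 (codeTerm index t) (codeTerm index u) 0 (codeTerm index v) (codeTerm index w) e
    in cong₂ eq (codeTerm-injective t v e₁) (codeTerm-injective u w e₂)
  sameFormula (atom r ts) (atom s us) refl e
    with e₁ , e₂ ← encode-injective (proj₁ r) (codeTerms index ts) (proj₁ s) (codeTerms index us)
           (tails 1 (proj₁ r ∷ codeTerms index ts) 1 (proj₁ s ∷ codeTerms index us) e)
    with refl ← symbol {a = r} {s} e₁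
    = cong (atom r) (codeTerms-injective ts us e₂)
  sameFormula (¬′ Φ) (¬′ Ψ) refl e =
    cong ¬′_ (codeFormula-injective Φ Ψ (argument 2 (codeFormula index Φ) 2 (codeFormula index Ψ) e))
  sameFormula (Φ ∧′ Φ′) (Ψ ∧′ Ψ′) refl e =
    let e₁ , e₂ = arguments 3 (codeFormula index Φ) (codeFormula index Φ′) 3 (codeFormula index Ψ) (codeFormula index Ψ′) e
    in cong₂ _∧′_ (codeFormula-injective Φ Ψ e₁) (codeFormula-injective Φ′ Ψ′ e₂)
  sameFormula (Φ ∨′ Φ′) (Ψ ∨′ Ψ′) refl e =
    let e₁ , e₂ = arguments 4 (codeFormula index Φ) (codeFormula index Φ′) 4 (codeFormula index Ψ) (codeFormula index Ψ′) e
    in cong₂ _∨′_ (codeFormula-injective Φ Ψ e₁) (codeFormula-injective Φ′ Ψ′ e₂)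
  sameFormula (∃′ Φ) (∃′ Ψ) refl e =
    cong ∃′_ (codeFormula-injective Φ Ψ (argument 5 (codeFormula index Φ) 5 (codeFormula index Ψ) e))
  sameFormula (∀′ Φ) (∀′ Ψ) refl e =
    cong ∀′_ (codeFormula-injective Φ Ψ (argument 6 (codeFormula index Φ) 6 (codeFormula index Ψ) e))

-- Quantifier classes and prenex negation

module _ {L : Language} {P : Set} where

  Σ⊆Σ : ∀ {k m} {Φ : Formula L P m} → IsΣ k Φ → IsΣ (suc k) Φ
  Π⊆Π : ∀ {k m} {Φ : Formula L P m} → IsΠ k Φ → IsΠ (suc k) Φ
  Σ⊆Σ (qf q)    = fromΠ (qf q)
  Σ⊆Σ (fromΠ h) = fromΠ (Π⊆Π h)
  Σ⊆Σ (∃Σ h)    = ∃Σ (Σ⊆Σ h)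
  Π⊆Π (qf q)    = fromΣ (qf q)
  Π⊆Π (fromΣ h) = fromΣ (Σ⊆Σ h)
  Π⊆Π (∀Π h)    = ∀Π (Π⊆Π h)

  Σ-mono : ∀ {k l m} {Φ : Formula L P m} → k ≤′ l → IsΣ k Φ → IsΣ l Φ
  Σ-mono ≤′-refl       h = h
  Σ-mono (≤′-step k≤l) h = Σ⊆Σ (Σ-mono k≤l h)

  Σ-body : ∀ {k m} {Φ : Formula L P (suc m)} → IsΣ k (∃′ Φ) → IsΣ k Φ
  Σ-body (qf ())
  Σ-body (fromΠ (qf ()))
  -- The formula may have passed through an empty existential and an empty universal block; its body
  -- then lies two levels lower and is lifted back.
  Σ-body (fromΠ (fromΣ h)) = Σ⊆Σ (Σ⊆Σ (Σ-body h))
  Σ-body (∃Σ h)            = h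

  -- The condition a ≢ 5 says that Φ does not begin with ∃′.
  data Block n (index : P → ℕ) : ∀ {m} → Formula L P m → Set where
    base : ∀ {m} {Φ : Formula L P m} a b → codeFormula index Φ ≡ cons a b → a ≢ 5 → IsΠ n Φ → Block n index Φ
    ex   : ∀ {m} {Φ : Formula L P (suc m)} → Block n index Φ → Block n index (∃′ Φ)

  -- A derivation of `IsΣ` may end the leading block early and meet further existential quantifiers
  -- at a lower level. Here the block is taken maximal, so that its length can be read off the code.
  block : ∀ {n index m} (Φ : Formula L P m) → IsΣ (suc n) Φ → Block n index Φ
  block {index = index} (eq t u)    (fromΠ h) = base 0 _ (encode-∷ 0 (codeTerm index t ∷ codeTerm index u ∷ [])) (λ ()) h
  block {index = index} (atom r ts) (fromΠ h) = base 1 _ (encode-∷ 1 (proj₁ r ∷ codeTerms index ts)) (λ ()) h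
  block {index = index} (¬′ Φ)      (fromΠ h) = base 2 _ (encode-∷ 2 (codeFormula index Φ ∷ [])) (λ ()) h
  block {index = index} (Φ ∧′ Ψ)    (fromΠ h) = base 3 _ (encode-∷ 3 (codeFormula index Φ ∷ codeFormula index Ψ ∷ [])) (λ ()) h
  block {index = index} (Φ ∨′ Ψ)    (fromΠ h) = base 4 _ (encode-∷ 4 (codeFormula index Φ ∷ codeFormula index Ψ ∷ [])) (λ ()) h
  block (∃′ Φ)                      h         = ex (block Φ (Σ-body h))
  block {index = index} (∀′ Φ)      (fromΠ h) = base 6 _ (encode-∷ 6 (codeFormula index Φ ∷ [])) (λ ()) h

module _ (em : ExcludedMiddle 0ℓ) where

  stable : ∀ {A : Set} → ¬ ¬ A → A
  stable = decidable-stable em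

  ¬∀⇔∃¬ : ∀ {A : Set} {X Y : A → Set} → (∀ a → X a ⇔ (¬ Y a)) → ∃ X ⇔ (¬ (∀ a → Y a))
  ¬∀⇔∃¬ e = mk⇔ (λ (a , x) all → to (e a) x (all a))
    (λ ¬all → stable λ none → ¬all λ a → stable λ ¬y → none (a , from (e a) ¬y))

  ¬∃⇔∀¬ : ∀ {A : Set} {X Y : A → Set} → (∀ a → X a ⇔ (¬ Y a)) → (∀ a → X a) ⇔ (¬ ∃ Y)
  ¬∃⇔∀¬ e = mk⇔ (λ all (a , y) → to (e a) (all a) y) (λ none a → from (e a) λ y → none (a , y))

  module _ {L : Language} {P : Set} where

    -- One dual has to serve all structures of the sequence at once, hence the quantification over M
    -- after the choice of Ψ.
    dualΠ : ∀ {k m} {Φ : Formula L P m} → IsΠ k Φ → ∃ λ Ψ → IsΣ k Ψ ×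
      (∀ (M : Structure L) E ρ → Sat M E Ψ ρ ⇔ (¬ Sat M E Φ ρ))
    dualΣ : ∀ {k m} {Φ : Formula L P m} → IsΣ k Φ → ∃ λ Ψ → IsΠ k Ψ ×
      (∀ (M : Structure L) E ρ → Sat M E Ψ ρ ⇔ (¬ Sat M E Φ ρ))
    dualΠ (qf q)    = _ , qf (neg q) , λ M E ρ → mk⇔ id id
    dualΠ (fromΣ h) = let Ψ , h′ , e = dualΣ h in Ψ , fromΠ h′ , e
    dualΠ (∀Π h)    = let Ψ , h′ , e = dualΠ h in ∃′ Ψ , ∃Σ h′ , λ M E ρ → ¬∀⇔∃¬ (λ a → e M E (a ∷ ρ))
    dualΣ (qf q)    = _ , qf (neg q) , λ M E ρ → mk⇔ id id
    dualΣ (fromΠ h) = let Ψ , h′ , e = dualΠ h in Ψ , fromΣ h′ , e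
    dualΣ (∃Σ h)    = let Ψ , h′ , e = dualΣ h in ∀′ Ψ , ∀Π h′ , λ M E ρ → ¬∃⇔∀¬ (λ a → e M E (a ∷ ρ))

-- Correctness of substitution in codes

module SubstitutionCorrect (em : ExcludedMiddle 0ℓ) (parameter : ℕ → ℕ → ℕ → ℕ)
  (parameterᴿ : Rec {3} (λ xs → parameter (lookup xs zero) (lookup xs (suc zero)) (lookup xs (suc (suc zero)))))
  {L : Language} {P : Set} (index : P → ℕ) (B : ℕStructure L) (e : P → ℕStructure.Elem B)
  (t i bound : ℕ) (e-correct : ∀ q → index q ≤ bound → pred (parameter t (index q) i) ≡ proj₁ (e q))
  {m} (ρ : Vec (ℕStructure.Elem B) m) where

  open ℕStructure B
  open Substitution parameter parameterᴿ

  private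
    r = encode (values ρ)

  -- The bound matters at parameters: the index of a parameter is smaller than any code in which it
  -- occurs, so correct values are needed for finitely many indices only.
  substTerm-correct : ∀ d (x : Term L P (d + m)) → codeTerm index x ≤ bound →
    ∃ λ (u : Term L Elem d) →
      codeTerm proj₁ u ≡ substTerm (codeTerm index x) (d ∷ r ∷ t ∷ i ∷ []) ×
      (∀ σ → eval structure id σ u ≡ eval structure e (σ ++ ρ) x)
  substTerms-correct : ∀ d {k} (xs : Vec (Term L P (d + m)) k) → encode (codeTerms index xs) ≤ bound →
    ∃ λ (us : Vec (Term L Elem d) k) →
      encode (codeTerms proj₁ us) ≡ substTerm (encode (codeTerms index xs)) (d ∷ r ∷ t ∷ i ∷ []) ×
      (∀ σ → evals structure id σ us ≡ evals structure e (σ ++ ρ) xs)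

  private
    U : ℕ → ℕ → ℕ
    U d c = substTerm c (d ∷ r ∷ t ∷ i ∷ [])

    3≤codeTerm : ∀ {m} (x : Term L P m) → 3 ≤ codeTerm index x
    3≤codeTerm (var x)    = subst (3 ≤_) (sym (encode₂ 0 (toℕ x) [])) (3≤cons-cons _ _ _)
    3≤codeTerm (par q)    = subst (3 ≤_) (sym (encode₂ 1 (index q) [])) (3≤cons-cons _ _ _)
    3≤codeTerm (app f ts) = subst (3 ≤_) (sym (encode₂ 2 (proj₁ f) _)) (3≤cons-cons _ _ _)

    ≤-head : ∀ {k} x (xs : Vec ℕ k) → encode (x ∷ xs) ≤ bound → x ≤ bound
    ≤-head x xs le = ≤-trans (<⇒≤ (<cons₁ x _)) (subst (_≤ bound) (encode-∷ x xs) le)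

    ≤-tail : ∀ {k} x (xs : Vec ℕ k) → encode (x ∷ xs) ≤ bound → encode xs ≤ bound
    ≤-tail x xs le = ≤-trans (<⇒≤ (<cons₂ x _)) (subst (_≤ bound) (encode-∷ x xs) le)

  substTerm-correct d (var x) le with splitAt d x in s≡
  ... | inj₁ y with refl ← splitAt⁻¹-↑ˡ {d} s≡ = var y , code≡ , λ σ → sym (lookup-++ˡ σ ρ y)
    where
    open ≡-Reasoning
    code≡ : encode (0 ∷ toℕ y ∷ []) ≡ U d (encode (0 ∷ toℕ (y ↑ˡ m) ∷ []))
    code≡ = begin
      encode (0 ∷ toℕ y ∷ [])                ≡⟨ encode₂ 0 (toℕ y) [] ⟩
      cons 0 (cons (toℕ y) 0)                ≡⟨ substTerm-bound d r t i (toℕ y) (toℕ<n y) ⟨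
      U d (cons 0 (cons (toℕ y) 0))          ≡⟨ cong (U d) (encode₂ 0 (toℕ y) []) ⟨
      U d (encode (0 ∷ toℕ y ∷ []))          ≡⟨ cong (λ v → U d (encode (0 ∷ v ∷ []))) (toℕ-↑ˡ y m) ⟨
      U d (encode (0 ∷ toℕ (y ↑ˡ m) ∷ []))   ∎
  ... | inj₂ y with refl ← splitAt⁻¹-↑ʳ {d} s≡ = par (lookup ρ y) , code≡ , λ σ → sym (lookup-++ʳ σ ρ y)
    where
    open ≡-Reasoning
    code≡ : encode (1 ∷ proj₁ (lookup ρ y) ∷ []) ≡ U d (encode (0 ∷ toℕ (d ↑ʳ y) ∷ []))
    code≡ = begin
      encode (1 ∷ proj₁ (lookup ρ y) ∷ [])   ≡⟨ encode₂ 1 _ [] ⟩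
      cons 1 (cons (proj₁ (lookup ρ y)) 0)   ≡⟨ cong (λ a → cons 1 (cons a 0)) (lookup-map y proj₁ ρ) ⟨
      cons 1 (cons (lookup (values ρ) y) 0)  ≡⟨ cong (λ a → cons 1 (cons a 0)) (nth-encode y (values ρ)) ⟨
      cons 1 (cons (nth (toℕ y) r) 0)        ≡⟨ substTerm-free d r t i (toℕ y) ⟨
      U d (cons 0 (cons (d + toℕ y) 0))      ≡⟨ cong (U d) (encode₂ 0 (d + toℕ y) []) ⟨
      U d (encode (0 ∷ (d + toℕ y) ∷ []))    ≡⟨ cong (λ v → U d (encode (0 ∷ v ∷ []))) (toℕ-↑ʳ d y) ⟨
      U d (encode (0 ∷ toℕ (d ↑ʳ y) ∷ []))   ∎
  substTerm-correct d (par q) le = par (e q) , code≡ , λ σ → refl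
    where
    open ≡-Reasoning
    q≤ : index q ≤ bound
    q≤ = ≤-head (index q) [] (≤-tail 1 (index q ∷ []) le)
    code≡ : encode (1 ∷ proj₁ (e q) ∷ []) ≡ U d (encode (1 ∷ index q ∷ []))
    code≡ = begin
      encode (1 ∷ proj₁ (e q) ∷ [])                          ≡⟨ encode₂ 1 _ [] ⟩
      cons 1 (cons (proj₁ (e q)) 0)                          ≡⟨ cong (λ a → cons 1 (cons a 0)) (e-correct q q≤) ⟨
      cons 1 (cons (pred (parameter t (index q) i)) 0)      ≡⟨ substTerm-par d r t i (index q) ⟨
      U d (cons 1 (cons (index q) 0))                        ≡⟨ cong (U d) (encode₂ 1 (index q) []) ⟨
      U d (encode (1 ∷ index q ∷ []))                        ∎
  substTerm-correct d (app f ts) le =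
    let us , code≡ , eval≡ = substTerms-correct d ts
          (≤-tail (proj₁ f) (codeTerms index ts) (≤-tail 2 (proj₁ f ∷ codeTerms index ts) le))
    in app f us ,
       trans (encode₂ 2 (proj₁ f) (codeTerms proj₁ us))
         (trans (cong (λ c → cons 2 (cons (proj₁ f) c)) code≡)
         (trans (sym (substTerm-app d r t i (proj₁ f) (encode (codeTerms index ts))))
           (cong (U d) (sym (encode₂ 2 (proj₁ f) (codeTerms index ts)))))) ,
       λ σ → cong (fun f) (eval≡ σ)
  substTerms-correct d []       le = [] , sym (substTerm-[] d r t i) , λ σ → refl
  substTerms-correct d (x ∷ xs) le =
    let u , u≡ , eval-u = substTerm-correct d x (≤-head (codeTerm index x) (codeTerms index xs) le)
        us , us≡ , eval-us = substTerms-correct d xs (≤-tail (codeTerm index x) (codeTerms index xs) le)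
    in u ∷ us ,
       trans (encode-∷ (codeTerm proj₁ u) (codeTerms proj₁ us))
         (trans (cong₂ cons u≡ us≡)
         (trans (sym (substTerm-∷ d r t i _ _ (3≤codeTerm x)))
           (cong (U d) (sym (encode-∷ (codeTerm index x) (codeTerms index xs)))))) ,
       λ σ → cong₂ _∷_ (eval-u σ) (eval-us σ)

  private
    G : ℕ → ℕ → ℕ
    G d c = substQF c (d ∷ r ∷ t ∷ i ∷ [])

  substQF-correct : ∀ d {Φ : Formula L P (d + m)} → QuantifierFree Φ → codeFormula index Φ ≤ bound →
    ∃ λ (Ψ : Formula L Elem d) → QuantifierFree Ψ ×
      codeFormula proj₁ Ψ ≡ substQF (codeFormula index Φ) (d ∷ r ∷ t ∷ i ∷ []) ×
      (∀ σ → Sat structure id Ψ σ ⇔ Sat structure e Φ (σ ++ ρ))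
  substQF-correct d (eq {t = x} {y}) le with substTerms-correct d (x ∷ y ∷ [])
    (≤-tail 0 (codeTerm index x ∷ codeTerm index y ∷ []) le)
  ... | u ∷ v ∷ [] , code≡ , eval≡ = eq u v , eq ,
    trans (encode-∷ 0 (codeTerm proj₁ u ∷ codeTerm proj₁ v ∷ []))
      (trans (cong (cons 0) code≡)
      (trans (sym (substQF-eq d r t i _))
        (cong (G d) (sym (encode-∷ 0 (codeTerm index x ∷ codeTerm index y ∷ [])))))) ,
    λ σ → mk⇔ (λ h → trans (sym (cong head (eval≡ σ))) (trans h (cong (head ∘ tail) (eval≡ σ))))
              (λ h → trans (cong head (eval≡ σ)) (trans h (sym (cong (head ∘ tail) (eval≡ σ)))))
  substQF-correct d (atom {s} {ts}) le =
    let us , code≡ , eval≡ = substTerms-correct d ts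
          (≤-tail (proj₁ s) (codeTerms index ts) (≤-tail 1 (proj₁ s ∷ codeTerms index ts) le))
    in atom s us , atom ,
       trans (encode₂ 1 (proj₁ s) (codeTerms proj₁ us))
         (trans (cong (λ c → cons 1 (cons (proj₁ s) c)) code≡)
         (trans (sym (substQF-atom d r t i (proj₁ s) (encode (codeTerms index ts))))
           (cong (G d) (sym (encode₂ 1 (proj₁ s) (codeTerms index ts)))))) ,
       λ σ → mk⇔ (subst (rel s) (eval≡ σ)) (subst (rel s) (sym (eval≡ σ)))
  substQF-correct d (neg {Φ} q) le =
    let Ψ , q′ , code≡ , sat = substQF-correct d q (≤-head (codeFormula index Φ) [] (≤-tail 2 (codeFormula index Φ ∷ []) le))
    in ¬′ Ψ , neg q′ ,
       trans (encode₂ 2 (codeFormula proj₁ Ψ) [])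
         (trans (cong (λ c → cons 2 (cons c 0)) code≡)
         (trans (sym (substQF-¬ d r t i (codeFormula index Φ)))
           (cong (G d) (sym (encode₂ 2 (codeFormula index Φ) []))))) ,
       λ σ → ¬-cong-⇔ (sat σ)
  substQF-correct d (and {Φ} {Φ′} q q′) le =
    let le′ = ≤-tail 3 (codeFormula index Φ ∷ codeFormula index Φ′ ∷ []) le
        Ψ , p , code≡ , sat = substQF-correct d q (≤-head (codeFormula index Φ) (codeFormula index Φ′ ∷ []) le′)
        Ψ′ , p′ , code≡′ , sat′ = substQF-correct d q′ (≤-head (codeFormula index Φ′) []
          (≤-tail (codeFormula index Φ) (codeFormula index Φ′ ∷ []) le′))
    in Ψ ∧′ Ψ′ , and p p′ ,
       trans (encode₃ 3 (codeFormula proj₁ Ψ) (codeFormula proj₁ Ψ′) [])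
         (trans (cong₂ (λ c c′ → cons 3 (cons c (cons c′ 0))) code≡ code≡′)
         (trans (sym (substQF-binary d r t i 0 (codeFormula index Φ) (codeFormula index Φ′)))
           (cong (G d) (sym (encode₃ 3 (codeFormula index Φ) (codeFormula index Φ′) []))))) ,
       λ σ → sat σ ×-⇔ sat′ σ
  substQF-correct d (or {Φ} {Φ′} q q′) le =
    let le′ = ≤-tail 4 (codeFormula index Φ ∷ codeFormula index Φ′ ∷ []) le
        Ψ , p , code≡ , sat = substQF-correct d q (≤-head (codeFormula index Φ) (codeFormula index Φ′ ∷ []) le′)
        Ψ′ , p′ , code≡′ , sat′ = substQF-correct d q′ (≤-head (codeFormula index Φ′) []
          (≤-tail (codeFormula index Φ) (codeFormula index Φ′ ∷ []) le′))
    in Ψ ∨′ Ψ′ , or p p′ ,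
       trans (encode₃ 4 (codeFormula proj₁ Ψ) (codeFormula proj₁ Ψ′) [])
         (trans (cong₂ (λ c c′ → cons 4 (cons c (cons c′ 0))) code≡ code≡′)
         (trans (sym (substQF-binary d r t i 1 (codeFormula index Φ) (codeFormula index Φ′)))
           (cong (G d) (sym (encode₃ 4 (codeFormula index Φ) (codeFormula index Φ′) []))))) ,
       λ σ → sat σ ⊎-⇔ sat′ σ

  private
    D : ℕ → ℕ → ℕ
    D d c = substDual c (d ∷ r ∷ t ∷ i ∷ [])

    qf-code : ∀ {k} {Φ : Formula L P k} → QuantifierFree Φ → ∃₂ λ a b → a ∸ 4 ≡ 0 × codeFormula index Φ ≡ cons a b
    qf-code (eq {x} {y})     = 0 , _ , refl , encode-∷ 0 (codeTerm index x ∷ codeTerm index y ∷ [])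
    qf-code (atom {s} {ts})  = 1 , _ , refl , encode-∷ 1 (proj₁ s ∷ codeTerms index ts)
    qf-code (neg {Φ} _)      = 2 , _ , refl , encode-∷ 2 (codeFormula index Φ ∷ [])
    qf-code (and {Φ} {Ψ} _ _) = 3 , _ , refl , encode-∷ 3 (codeFormula index Φ ∷ codeFormula index Ψ ∷ [])
    qf-code (or {Φ} {Ψ} _ _)  = 4 , _ , refl , encode-∷ 4 (codeFormula index Φ ∷ codeFormula index Ψ ∷ [])

  module _ (total : ℕ) where

    -- `total` is the length of the whole prefix and d the number of quantifiers already passed. The
    -- equation makes them agree at the matrix, where `substQF` uses the value `total`.
    Dual : ∀ d → Formula L P (d + m) → (Formula L Elem d → Set) → Set
    Dual d Φ IsX = total ≡ d + depth (codeFormula index Φ) → codeFormula index Φ ≤ bound →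
      ∃ λ (Ψ : Formula L Elem d) → IsX Ψ × codeFormula proj₁ Ψ ≡ D total (codeFormula index Φ) ×
        (∀ σ → Sat structure id Ψ σ ⇔ (¬ Sat structure e Φ (σ ++ ρ)))

    private
      dual-qf : ∀ d {Φ : Formula L P (d + m)} → QuantifierFree Φ → Dual d Φ QuantifierFree
      dual-qf d {Φ} q total≡ le with qf-code q
      ... | a , b , a≤4 , code≡
        with refl ← trans total≡ (trans (cong (d +_) (trans (cong depth code≡) (depth-qf a b a≤4))) (+-identityʳ d)) =
        let Ψ , q′ , code≡′ , sat = substQF-correct d q le
        in ¬′ Ψ , neg q′ ,
           trans (encode₂ 2 (codeFormula proj₁ Ψ) [])
             (trans (cong (λ c → cons 2 (cons c 0)) (trans code≡′ (cong (G d) code≡)))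
             (trans (sym (substDual-qf d r t i a b a≤4)) (cong (D d) (sym code≡)))) ,
           λ σ → ¬-cong-⇔ (sat σ)

      total-body : ∀ a d (Φ : Formula L P (suc d + m)) →
        total ≡ d + depth (encode (5 + a ∷ codeFormula index Φ ∷ [])) →
        total ≡ suc d + depth (codeFormula index Φ)
      total-body a d Φ total≡ = trans total≡ (trans
        (cong (d +_) (trans (cong depth (encode₂ (5 + a) (codeFormula index Φ) [])) (depth-quantifier a _ 0)))
        (+-suc d _))

    substDual-Π : ∀ d {k} {Φ : Formula L P (d + m)} → IsΠ k Φ → Dual d Φ (IsΣ k)
    substDual-Σ : ∀ d {k} {Φ : Formula L P (d + m)} → IsΣ k Φ → Dual d Φ (IsΠ k)
    substDual-Π d (qf q)    total≡ le = let Ψ , q′ , rest = dual-qf d q total≡ le in Ψ , qf q′ , rest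
    substDual-Π d (fromΣ h) total≡ le = let Ψ , h′ , rest = substDual-Σ d h total≡ le in Ψ , fromΠ h′ , rest
    substDual-Π d (∀Π {Φ = Φ} h) total≡ le =
      let Ψ , h′ , code≡ , sat = substDual-Π (suc d) h (total-body 1 d Φ total≡)
            (≤-head (codeFormula index Φ) [] (≤-tail 6 (codeFormula index Φ ∷ []) le))
      in ∃′ Ψ , ∃Σ h′ ,
         trans (encode₂ 5 (codeFormula proj₁ Ψ) [])
           (trans (cong (λ c → cons 5 (cons c 0)) code≡)
           (trans (sym (substDual-∀ total r t i (codeFormula index Φ)))
             (cong (D total) (sym (encode₂ 6 (codeFormula index Φ) []))))) ,
         λ σ → ¬∀⇔∃¬ em (λ a → sat (a ∷ σ))
    substDual-Σ d (qf q)    total≡ le = let Ψ , q′ , rest = dual-qf d q total≡ le in Ψ , qf q′ , rest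
    substDual-Σ d (fromΠ h) total≡ le = let Ψ , h′ , rest = substDual-Π d h total≡ le in Ψ , fromΣ h′ , rest
    substDual-Σ d (∃Σ {Φ = Φ} h) total≡ le =
      let Ψ , h′ , code≡ , sat = substDual-Σ (suc d) h (total-body 0 d Φ total≡)
            (≤-head (codeFormula index Φ) [] (≤-tail 5 (codeFormula index Φ ∷ []) le))
      in ∀′ Ψ , ∀Π h′ ,
         trans (encode₂ 6 (codeFormula proj₁ Ψ) [])
           (trans (cong (λ c → cons 6 (cons c 0)) code≡)
           (trans (sym (substDual-∃ total r t i (codeFormula index Φ)))
             (cong (D total) (sym (encode₂ 5 (codeFormula index Φ) []))))) ,
         λ σ → ¬∃⇔∀¬ em (λ a → sat (a ∷ σ))

-- Verification of Σₙ₊₁ formulas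

elem-injective : ∀ {L} (B : ℕStructure L) {a b : ℕStructure.Elem B} → proj₁ a ≡ proj₁ b → a ≡ b
elem-injective B {_ , p} {_ , q} refl = cong (_ ,_) (T-irrelevant p q)

module Truth (em : ExcludedMiddle 0ℓ) {L : Language} (n : ℕ) (A : ℕ → ℕStructure L)
  (A-decidable : UniformlyDecidable A n) {P : Set} (index : P → ℕ)
  (e : ∀ i → P → ℕStructure.Elem (A i))
  (parameter : ℕ → ℕ → ℕ → ℕ)
  (parameterᴿ : Rec {3} (λ xs → parameter (lookup xs zero) (lookup xs (suc zero)) (lookup xs (suc (suc zero)))))
  (parameter-sound : ∀ t q i {a} → parameter t (index q) i ≡ suc a → proj₁ (e i q) ≡ a) where

  open Substitution parameter parameterᴿ
  private module A i = ℕStructure (A i)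

  enc : ∀ i {m} → Vec (A.Elem i) m → ℕ
  enc i ρ = encode (A.values i ρ)

  -- Since the parameters of a formula have indices below its code c, asking for all indices up to c
  -- avoids parsing the formula.
  ParametersDefined : ℕ → ℕ → ℕ → Set
  ParametersDefined t c i = ∀ ℓ → ℓ < suc c → parameter t ℓ i ≢ 0

  IsEntry : ℕ → ℕ → Set
  IsEntry i l = l ≡ cons (hd l) (tl l) × T (A.domain i (hd l))

  -- The given diagram decides Σₙ sentences, so a Πₙ formula counts as true if its dual, with all
  -- parameters and the tuple r substituted, is absent.
  ΠTrue : ℕ → ℕ → ℕ → ℕ → Set
  ΠTrue i c r t = ¬ ΣDiagram (A i) n (substDual c (depth c ∷ r ∷ t ∷ i ∷ []) ∷ [])

  -- r′ extends r by witnesses for the first k existential quantifiers of the formula with code c.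
  Witnessed : ℕ → ℕ → ℕ → ℕ → ℕ → ℕ → Set
  Witnessed i c r t k r′ = drop k r′ ≡ r × (∀ j → j < k → IsEntry i (drop j r′)) ×
    strip k c ≢ 0 × hd (strip k c) ≢ 5 × ΠTrue i (strip k c) r′ t

  -- w lists the fuel for the parameters, the number k of witnesses, and then the tuple r extended
  -- by these witnesses.
  Verifies : ℕ → ℕ → ℕ → ℕ → Set
  Verifies i c r w = ParametersDefined (hd w) c i × Witnessed i c r (hd w) (hd (tl w)) (tl (tl w))

  Entryᶜ : ∀ {k f g} → Rec {k} f → Rec g → Computable (λ xs → IsEntry (f xs) (g xs))
  Entryᶜ i l = (l ≡ᶜ consᴿ (hdᴿ l) (tlᴿ l)) ×ᶜ
    (IsUniformlyComputable.domain-computable (proj₁ A-decidable) ∙ (i ∷ᴿ hdᴿ l ∷ᴿ []ᴿ))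

  Verifiesᶜ : Computable {4} λ xs → Verifies (lookup xs zero) (lookup xs (suc zero))
    (lookup xs (suc (suc zero))) (lookup xs (suc (suc (suc zero))))
  Verifiesᶜ =
    ∀<ᶜ (sucᴿ x₁) (¬ᶜ (parameterᴿ · (hdᴿ x₄ ∷ᴿ x₀ ∷ᴿ x₁ ∷ᴿ []ᴿ) ≡ᶜ const 0)) ×ᶜ
    (dropᴿ k r′ ≡ᶜ x₂) ×ᶜ
    ∀<ᶜ k (Entryᶜ x₁ (dropᴿ x₀ (tlᴿ (tlᴿ x₄)))) ×ᶜ
    ¬ᶜ (c ≡ᶜ const 0) ×ᶜ
    ¬ᶜ (hdᴿ c ≡ᶜ const 5) ×ᶜ
    ¬ᶜ (proj₂ A-decidable ∙ (x₀ ∷ᴿ substDualᴿ c (depthᴿ c ∷ᴿ r′ ∷ᴿ hdᴿ x₃ ∷ᴿ x₀ ∷ᴿ []ᴿ) ∷ᴿ []ᴿ))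
    where
    k = hdᴿ (tlᴿ (x₃ {0}))
    r′ = tlᴿ (tlᴿ (x₃ {0}))
    c = stripᴿ k (x₁ {2})

  module _ {i : ℕ} where

    private
      Holds : ∀ {m} → Formula L P m → Vec (A.Elem i) m → Set
      Holds = Sat (A.structure i) (e i)

    -- Witnesses are consed in front, innermost last, so the outermost one stands at position k - 1.
    -- The case k = 0 is excluded because the stripped code must not have tag 5.
    Witnessed-∃ : ∀ {m} (Φ : Formula L P (suc m)) {ρ : Vec (A.Elem i) m} {t k r′} →
      Witnessed i (codeFormula index (∃′ Φ)) (enc i ρ) t k r′ →
      ∃ λ (a∈ : T (A.domain i (nth (pred k) r′))) →
        Witnessed i (codeFormula index Φ) (enc i ((_ , a∈) ∷ ρ)) t (pred k) r′
    Witnessed-∃ Φ {k = zero} (_ , _ , _ , ≢5 , _) =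
      ⊥-elim (≢5 (trans (cong hd (encode₂ 5 (codeFormula index Φ) [])) (hd-cons 5 _)))
    Witnessed-∃ Φ {ρ} {t} {suc k} {r′} (drop≡ , entries , ≢0 , ≢5 , true) =
      a∈ , trans entry (trans (cong (cons (nth k r′)) drop≡) (sym (encode-∷ (nth k r′) (A.values i ρ)))) ,
      (λ j j<k → entries j (m<n⇒m<1+n j<k)) ,
      subst (_≢ 0) strip≡ ≢0 , subst (λ c → hd c ≢ 5) strip≡ ≢5 , subst (λ c → ΠTrue i c r′ t) strip≡ true
      where
      entry = proj₁ (entries k (n<1+n k))
      a∈ = proj₂ (entries k (n<1+n k))
      strip≡ : strip (suc k) (codeFormula index (∃′ Φ)) ≡ strip k (codeFormula index Φ)
      strip≡ = trans (strip-matrix k (codeFormula index (∃′ Φ)))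
        (cong (strip k) (trans (cong matrix (encode₂ 5 (codeFormula index Φ) [])) (matrix-∃ _ 0)))

    Witnessed-∃⁻ : ∀ {m} (Φ : Formula L P (suc m)) {ρ : Vec (A.Elem i) m} {a t k r′} →
      Witnessed i (codeFormula index Φ) (enc i (a ∷ ρ)) t k r′ →
      Witnessed i (codeFormula index (∃′ Φ)) (enc i ρ) t (suc k) r′
    Witnessed-∃⁻ Φ {ρ} {a} {t} {k} {r′} (drop≡ , entries , ≢0 , ≢5 , true) =
      trans (cong tl drop≡′) (tl-cons (proj₁ a) _) , entries′ ,
      subst (_≢ 0) strip≡ ≢0 , subst (λ c → hd c ≢ 5) strip≡ ≢5 , subst (λ c → ΠTrue i c r′ t) strip≡ true
      where
      drop≡′ : drop k r′ ≡ cons (proj₁ a) (enc i ρ)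
      drop≡′ = trans drop≡ (encode-∷ (proj₁ a) (A.values i ρ))
      entries′ : ∀ j → j < suc k → IsEntry i (drop j r′)
      entries′ j j<1+k with m≤n⇒m<n∨m≡n (≤-pred j<1+k)
      ... | inj₁ j<k  = entries j j<k
      ... | inj₂ refl = trans drop≡′ (sym (cong₂ cons hd≡ (trans (cong tl drop≡′) (tl-cons _ _)))) ,
                        subst (T ∘ A.domain i) (sym hd≡) (proj₂ a)
        where
        hd≡ : nth k r′ ≡ proj₁ a
        hd≡ = trans (cong hd drop≡′) (hd-cons _ _)
      strip≡ : strip k (codeFormula index Φ) ≡ strip (suc k) (codeFormula index (∃′ Φ))
      strip≡ = sym (trans (strip-matrix k (codeFormula index (∃′ Φ)))
        (cong (strip k) (trans (cong matrix (encode₂ 5 (codeFormula index Φ) [])) (matrix-∃ _ 0))))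

    module _ {t bound : ℕ} (defined : ParametersDefined t bound i) where

      e-correct : ∀ q → index q ≤ bound → pred (parameter t (index q) i) ≡ proj₁ (e i q)
      e-correct q q≤ with parameter t (index q) i in v≡ | defined (index q) (s≤s q≤)
      ... | zero  | ≢0 = ⊥-elim (≢0 refl)
      ... | suc a | _  = sym (parameter-sound t q i v≡)

      ΠTrue⇔ : ∀ {m} {Φ : Formula L P m} (ρ : Vec (A.Elem i) m) → IsΠ n Φ → codeFormula index Φ ≤ bound →
        ΠTrue i (codeFormula index Φ) (enc i ρ) t ⇔ Holds Φ ρ
      ΠTrue⇔ {Φ = Φ} ρ h le
        with SubstitutionCorrect.substDual-Π em parameter parameterᴿ index (A i) (e i) t i bound
               e-correct ρ (depth (codeFormula index Φ)) 0 h refl le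
      ... | Ψ , h′ , code≡ , sat = mk⇔
        (λ true → stable em λ ¬Φ → true (Ψ , (h′ , from (sat []) ¬Φ) , code≡))
        λ { Φ-holds (Ψ′ , (_ , Ψ′-holds) , code≡′) → to (sat [])
              (subst (λ Ψ → Sat (A.structure i) id Ψ [])
                (codeFormula-injective (elem-injective (A i)) Ψ′ Ψ (trans code≡′ (sym code≡))) Ψ′-holds)
              Φ-holds }

      private
        body≤ : ∀ {m} (Φ : Formula L P (suc m)) → codeFormula index (∃′ Φ) ≤ bound → codeFormula index Φ ≤ bound
        body≤ Φ le = ≤-trans (<⇒≤ (<-trans (<cons₁ _ 0) (<cons₂ 5 _)))
          (subst (_≤ bound) (encode₂ 5 (codeFormula index Φ) []) le)

      -- The two conditions on the stripped code force k to be the length of the maximal block: too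
      -- small a k leaves the tag 5, too large a k yields the code 0.
      Witnessed-sound : ∀ {m} {Φ : Formula L P m} → Block n index Φ → codeFormula index Φ ≤ bound →
        ∀ {ρ k r′} → Witnessed i (codeFormula index Φ) (enc i ρ) t k r′ → Holds Φ ρ
      Witnessed-sound (base a b code≡ a≢5 h) le {ρ} {zero} (refl , _ , _ , _ , true) = to (ΠTrue⇔ ρ h le) true
      Witnessed-sound {Φ = Φ} (base a b code≡ a≢5 h) le {k = suc k} (_ , _ , ≢0 , _) =
        ⊥-elim (≢0 (trans (strip-matrix k (codeFormula index Φ)) (trans
          (cong (strip k) (matrix-other _ (λ p → a≢5 (trans (sym (trans (cong hd code≡) (hd-cons a b))) p))))
          (strip-0 k))))
      Witnessed-sound (ex {Φ = Φ} bl) le w =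
        let a∈ , w′ = Witnessed-∃ Φ w in (_ , a∈) , Witnessed-sound bl (body≤ Φ le) w′

      Witnessed-complete : ∀ {m} {Φ : Formula L P m} → Block n index Φ → codeFormula index Φ ≤ bound →
        ∀ {ρ} → Holds Φ ρ → ∃₂ λ k r′ → Witnessed i (codeFormula index Φ) (enc i ρ) t k r′
      Witnessed-complete (base a b code≡ a≢5 h) le {ρ} holds =
        0 , enc i ρ , refl , (λ _ ()) , (λ c≡0 → cons≢0 (trans (sym code≡) c≡0)) ,
        (λ p → a≢5 (trans (sym (trans (cong hd code≡) (hd-cons a b))) p)) , from (ΠTrue⇔ ρ h le) holds
      Witnessed-complete (ex {Φ = Φ} bl) le (a , holds) =
        let k , r′ , w = Witnessed-complete bl (body≤ Φ le) {a ∷ _} holds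
        in suc k , r′ , Witnessed-∃⁻ Φ {a = a} w

    Verifies-sound : ∀ {m} {Φ : Formula L P m} → IsΣ (suc n) Φ → ∀ {ρ w} →
      Verifies i (codeFormula index Φ) (enc i ρ) w → Holds Φ ρ
    Verifies-sound {Φ = Φ} h (defined , w) = Witnessed-sound defined (block Φ h) ≤-refl w

    -- Besides truth of the body this exhibits the outermost witness as a recursive function of w,
    -- which is what a search can output.
    Verifies-sound-∃ : ∀ {m} {Φ : Formula L P (suc m)} → IsΣ (suc n) Φ → ∀ {ρ w} →
      Verifies i (codeFormula index (∃′ Φ)) (enc i ρ) w →
      ∃ λ (a∈ : T (A.domain i (nth (pred (hd (tl w))) (tl (tl w))))) → Holds Φ ((_ , a∈) ∷ ρ)
    Verifies-sound-∃ {Φ = Φ} h {w = w} (defined , v) =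
      let a∈ , v′ = Witnessed-∃ Φ v in a∈ , Witnessed-sound
        (λ ℓ ℓ≤ → defined ℓ (≤-trans ℓ≤ (s≤s (<⇒≤ (subst (codeFormula index Φ <_)
          (sym (encode₂ 5 (codeFormula index Φ) [])) (<-trans (<cons₁ _ 0) (<cons₂ 5 _)))))))
        (block Φ h) ≤-refl v′

    Verifies-complete : ∀ {m} {Φ : Formula L P m} → IsΣ (suc n) Φ → ∀ {ρ t} →
      ParametersDefined t (codeFormula index Φ) i → Holds Φ ρ →
      ∃ λ w → Verifies i (codeFormula index Φ) (enc i ρ) (cons t w)
    Verifies-complete {Φ = Φ} h {ρ} {t} defined holds with Witnessed-complete defined (block Φ h) ≤-refl holds
    ... | k , r′ , w = cons k r′ ,
      subst (λ t → ParametersDefined t (codeFormula index Φ) i) (sym (hd-cons t _)) defined ,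
      subst (λ t → Witnessed i (codeFormula index Φ) (enc i ρ) t (hd (tl w′)) (tl (tl w′))) (sym (hd-cons t _))
        (subst (λ v → Witnessed i (codeFormula index Φ) (enc i ρ) t (hd v) (tl v)) (sym (tl-cons t _))
          (subst₂ (Witnessed i (codeFormula index Φ) (enc i ρ) t) (sym (hd-cons k r′)) (sym (tl-cons k r′)) w))
      where w′ = cons t (cons k r′)

-- Łoś's theorem

least : ∀ {X : Pred ℕ 0ℓ} → (∀ z → Dec (X z)) → ∀ n → X n → ∃ λ m → X m × (∀ j → j < m → ¬ X j)
least {X} X? n x = Sum.[ id , (λ none → n , x , none) ]′ (below n)
  where
  below : ∀ n → (∃ λ m → X m × (∀ j → j < m → ¬ X j)) ⊎ (∀ j → j < n → ¬ X j)
  below zero    = inj₂ λ _ ()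
  below (suc n) with below n | X? n
  ... | inj₁ found | _     = inj₁ found
  ... | inj₂ none  | yes x = inj₁ (n , x , none)
  ... | inj₂ none  | no ¬x = inj₂ λ j j<1+n → Sum.[ none j , (λ { refl → ¬x }) ]′ (m≤n⇒m<n∨m≡n (≤-pred j<1+n))

-- An unbounded search for z, followed by g; the code stays opaque, since later arguments use only
-- its soundness and completeness.
abstract
  search : ∀ {X : Pred (Vec ℕ 2) 0ℓ} {g} → Computable X → Rec g → ∃ λ (e : Code 1) →
    (∀ {i a} → e [ i ∷ [] ]↓ a → ∃ λ z → X (z ∷ i ∷ []) × g (z ∷ i ∷ []) ≡ a) ×
    (∀ {i z} → X (z ∷ i ∷ []) → dom e i)
  search {X} {g} c (rec h h↓) = comp h (mu d ∷ proj zero ∷ []) , sound , complete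
    where
    d : Code 2
    -- `mu` looks for a zero, hence the characteristic function of the complement of X.
    d = proj₁ (¬ᶜ c)
    d↓ : ∀ xs → (¬ X xs × d [ xs ]↓ 1) ⊎ (¬ ¬ X xs × d [ xs ]↓ 0)
    d↓ = proj₂ (¬ᶜ c)
    sound : ∀ {i a} → comp h (mu d ∷ proj zero ∷ []) [ i ∷ [] ]↓ a → ∃ λ z → X (z ∷ i ∷ []) × g (z ∷ i ∷ []) ≡ a
    sound {i} (comp↓ (mu↓ {y = z} d↓0 _ ∷ proj↓ _ ∷ []) h↓a) with d↓ (z ∷ i ∷ [])
    ... | inj₁ (_ , d↓1) with () ← ↓-functional d↓0 d↓1
    ... | inj₂ (¬¬x , _) = z , decidable-stable (decide c _) ¬¬x , ↓-functional (h↓ _) h↓a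
    complete : ∀ {i z} → X (z ∷ i ∷ []) → dom (comp h (mu d ∷ proj zero ∷ [])) i
    complete {i} {z} x with least (λ z → decide c (z ∷ i ∷ [])) z x
    ... | m , xm , none = _ , comp↓ (mu↓ d↓0 below ∷ proj↓ zero ∷ []) (h↓ _)
      where
      d↓0 : d [ m ∷ i ∷ [] ]↓ 0
      d↓0 with d↓ (m ∷ i ∷ [])
      ... | inj₁ (¬x , _) = ⊥-elim (¬x xm)
      ... | inj₂ (_ , d↓0) = d↓0
      below : ∀ z → z < m → ∃ λ w → d [ z ∷ i ∷ [] ]↓ suc w
      below z z<m with d↓ (z ∷ i ∷ [])
      ... | inj₁ (_ , d↓1) = 0 , d↓1
      ... | inj₂ (¬¬x , _) = ⊥-elim (¬¬x (none z z<m))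

⊆*-∀< : ∀ {C} {Y : ℕ → Pred ℕ 0ℓ} n → (∀ j → j < n → C ⊆* Y j) → C ⊆* λ i → ∀ j → j < n → Y j i
⊆*-∀< zero    h = ⊆*-universal λ _ _ ()
⊆*-∀< (suc n) h = ⊆*-mono
  (λ (ys , y) j j<1+n → Sum.[ ys j , (λ { refl → y }) ]′ (m≤n⇒m<n∨m≡n (≤-pred j<1+n)))
  (⊆*-∩ (⊆*-∀< n (λ j j<n → h j (m<n⇒m<1+n j<n))) (h n (n<1+n n)))

module Łoś (em : ExcludedMiddle 0ℓ) {L : Language} (n : ℕ) (A : ℕ → ℕStructure L)
  (A-decidable : UniformlyDecidable A n) (C : Pred ℕ 0ℓ) (C-cohesive : Cohesive C) where

  open CohesiveProduct A (proj₁ A-decidable) C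
  private module A i = ℕStructure (A i)

  ⊆*-disjoint : ∀ {Y} → C ⊆* Y → C ⊆* ∁ Y → ⊥
  ⊆*-disjoint p q = proj₁ C-cohesive
    (let l , sub = ⊆*-∩ p q in l , λ c → sub (c , λ (y , ¬y) → ¬y y))

  -- Outside the domain of φ the value is a junk element.
  val : D → ∀ i → A.Elem i
  val φ i with em {P = dom (D.code φ) i}
  ... | yes (a , d) = a , D.inDomain φ d
  ... | no _        = A.nonempty i

  vals : ∀ {m} → Vec D m → ∀ i → Vec (A.Elem i) m
  vals ρ i = map (λ φ → val φ i) ρ

  val↓ : ∀ φ {i a} → D.code φ [ i ∷ [] ]↓ a → proj₁ (val φ i) ≡ a
  val↓ φ {i} d with em {P = dom (D.code φ) i}
  ... | yes (_ , d′) = ↓-functional d′ d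
  ... | no none      = ⊥-elim (none (_ , d))

  val-code : ∀ φ {i a} → D.code φ [ i ∷ [] ]↓ a → D.code φ [ i ∷ [] ]↓ proj₁ (val φ i)
  val-code φ d = subst (D.code φ [ _ ]↓_) (sym (val↓ φ d)) d

  vals↓ : ∀ {m} (ρ : Vec D m) {i ys} → Pointwise (λ g → g [ i ∷ [] ]↓_) (map D.code ρ) ys →
    A.values i (vals ρ i) ≡ ys
  vals↓ []      []       = refl
  vals↓ (φ ∷ ρ) (d ∷ ds) = cong₂ _∷_ (val↓ φ d) (vals↓ ρ ds)

  vals⇓ : ∀ {m} {ρ : Vec D m} {i as} → ρ [ i ]⇓ as → as ≡ vals ρ i
  vals⇓ []                   = refl
  vals⇓ {ρ = φ ∷ _} {i} (d ∷ ds) = cong₂ _∷_ (elem-injective (A i) (sym (val↓ φ d))) (vals⇓ ds)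

  codes-defined : ∀ {m} {ρ : Vec D m} {i as} → ρ [ i ]⇓ as →
    Pointwise (λ g → g [ i ∷ [] ]↓_) (map D.code ρ) (A.values i as)
  codes-defined []       = []
  codes-defined (d ∷ ds) = d ∷ codes-defined ds

  -- Junk values do no harm, because both functions are defined at almost all elements of C.
  =C⇔ : ∀ φ ψ → φ =C ψ ⇔ (C ⊆* λ i → val φ i ≡ val ψ i)
  =C⇔ φ ψ = mk⇔
    (⊆*-mono λ {i} (a , d , d′) → elem-injective (A i) (trans (val↓ φ d) (sym (val↓ ψ d′))))
    (λ p → ⊆*-mono
      (λ {i} ((_ , d) , (_ , d′) , v≡) →
        _ , val-code φ d , subst (D.code ψ [ i ∷ [] ]↓_) (cong proj₁ (sym v≡)) (val-code ψ d′))
      (⊆*-∩ (D.C⊆*dom φ) (⊆*-∩ (D.C⊆*dom ψ) p)))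

  relD⇔ : ∀ r φs → relD r φs ⇔ (C ⊆* λ i → A.rel i r (vals φs i))
  relD⇔ r φs = mk⇔
    (⊆*-mono λ {i} (as , ds , h) → subst (A.rel i r) (vals⇓ ds) h)
    (λ p → ⊆*-mono
      (λ {i} ((as , ds) , h) → as , ds , subst (A.rel i r) (sym (vals⇓ ds)) h) (⊆*-∩ (allDefined φs) p))

  -- Covers uniform sequences and finite sets of parameters alike: E gives the parameters, and ψ
  -- gives representatives whose values `parameter` computes with bounded fuel.
  module Parametrized {P : Set} (index : P → ℕ) (E ψ : P → D) (ψ=E : ∀ q → ψ q =C E q)
    (parameter : ℕ → ℕ → ℕ → ℕ)
    (parameterᴿ : Rec {3} (λ xs → parameter (lookup xs zero) (lookup xs (suc zero)) (lookup xs (suc (suc zero)))))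
    (parameter-sound : ∀ t q i {a} → parameter t (index q) i ≡ suc a → D.code (ψ q) [ i ∷ [] ]↓ a)
    (parameter-defined : ∀ ℓ → C ⊆* λ i → Eventually (λ t → parameter t ℓ i ≢ 0)) where

    e : ∀ i → P → A.Elem i
    e i q = val (ψ q) i

    open Truth em n A A-decidable index e parameter parameterᴿ
      (λ t q i v≡ → val↓ (ψ q) (parameter-sound t q i v≡)) public

    Holds : ∀ {m} → Formula L P m → Vec D m → Pred ℕ 0ℓ
    Holds Φ ρ i = Sat (A.structure i) (e i) Φ (vals ρ i)

    parametersDefined : ∀ c → C ⊆* λ i → ∃ λ t → ParametersDefined t c i
    parametersDefined c = ⊆*-mono
      (λ h → let t₀ , defined = eventually-∀< (suc c) h in t₀ , defined t₀ ≤-refl)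
      (⊆*-∀< (suc c) (λ ℓ _ → parameter-defined ℓ))

    module _ {m} (Φ : Formula L P m) (Φ-Σ : IsΣ (suc n) Φ) (ρ : Vec D m) where

      private
        arguments : ℕ → ℕ → Vec ℕ m
        arguments t i = runs (map D.code ρ) t (i ∷ [])

        -- z lists a fuel for evaluating the tuple ρ at i, followed by a verification. Both are
        -- searched for together because the entries of ρ are partial.
        Accepts : ℕ → ℕ → Set
        Accepts z i = guard (arguments (hd z) i) ≢ 0 ×
          Verifies i (codeFormula index Φ) (encode (map pred (arguments (hd z) i))) (tl z)

        Acceptsᶜ : Computable {2} λ xs → Accepts (lookup xs zero) (lookup xs (suc zero))
        Acceptsᶜ =
          ¬ᶜ (guardᴿ argumentsᴿ ≡ᶜ const 0) ×ᶜ
          (Verifiesᶜ ∙ (x₁ ∷ᴿ const (codeFormula index Φ) ∷ᴿ encodeᴿ (map-predᴿ argumentsᴿ) ∷ᴿ tlᴿ x₀ ∷ᴿ []ᴿ))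
          where
          argumentsᴿ : Recs {2} λ xs → arguments (hd (lookup xs zero)) (lookup xs (suc zero))
          argumentsᴿ = runsᴿ (map D.code ρ) ·* (hdᴿ x₀ ∷ᴿ x₁ ∷ᴿ []ᴿ)

        Accepts-sound : ∀ {z i} → Accepts z i → Verifies i (codeFormula index Φ) (enc i (vals ρ i)) (tl z)
        Accepts-sound {z} {i} (g≢0 , v) with guard (arguments (hd z) i) in g≡
        ... | zero  = ⊥-elim (g≢0 refl)
        ... | suc _ = subst (λ ys → Verifies i (codeFormula index Φ) (encode ys) (tl z))
          (sym (vals↓ ρ (runs-sound (map D.code ρ) (hd z) g≡))) v

        Accepts-complete : ∀ {i} → (∃ λ as → ρ [ i ]⇓ as) → (∃ λ t → ParametersDefined t (codeFormula index Φ) i) →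
          Holds Φ ρ i → ∃ λ z → Accepts z i
        Accepts-complete {i} (as , ds) (t , defined) holds
          with refl ← vals⇓ ds
          with w , v ← Verifies-complete Φ-Σ defined holds
          with t₀ , all ← runs-complete (codes-defined ds)
          = cons t₀ (cons t w) , accepts
          where
          args≡ : arguments (hd (cons t₀ (cons t w))) i ≡ map suc (A.values i as)
          args≡ = trans (cong (λ t → arguments t i) (hd-cons t₀ _)) (all t₀ ≤-refl)
          accepts : Accepts (cons t₀ (cons t w)) i
          accepts rewrite args≡ | guard-suc (A.values i as) | map-pred-suc (A.values i as) | tl-cons t₀ (cons t w) =
            (λ ()) , v

      module _ {g} (gᴿ : Rec {2} g) where

        Σ-search : Code 1
        Σ-search = proj₁ (search Acceptsᶜ gᴿ)

        Σ-search-sound : ∀ {i a} → Σ-search [ i ∷ [] ]↓ a → ∃ λ z →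
          Verifies i (codeFormula index Φ) (enc i (vals ρ i)) (tl z) × g (z ∷ i ∷ []) ≡ a
        Σ-search-sound d = let z , acc , g≡a = proj₁ (proj₂ (search Acceptsᶜ gᴿ)) d in z , Accepts-sound acc , g≡a

        Σ-search-complete : C ⊆* λ i → Holds Φ ρ i → dom Σ-search i
        Σ-search-complete = ⊆*-mono
          (λ (ds , defined) holds → proj₂ (proj₂ (search Acceptsᶜ gᴿ)) (proj₂ (Accepts-complete ds defined holds)))
          (⊆*-∩ (allDefined ρ) (parametersDefined (codeFormula index Φ)))

      -- On C, up to finitely many elements, the formula holds exactly on the domain of the search
      -- for a verification. This domain is c.e., so cohesiveness plays the role of an ultrafilter.
      decided : C ⊆* Holds Φ ρ ⊎ C ⊆* ∁ (Holds Φ ρ)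
      decided = Sum.map
        (⊆*-mono λ {i} (_ , d) → let z , v , _ = Σ-search-sound x₀ d in Verifies-sound Φ-Σ {vals ρ i} {tl z} v)
        (λ p → ⊆*-mono (λ (¬d , complete) → ¬d ∘ complete) (⊆*-∩ p (Σ-search-complete x₀)))
        (proj₂ C-cohesive (dom (Σ-search x₀)) (Σ-search x₀ , id , id))

    -- The search succeeds at almost all i in C, and its output, the outermost witness, is then
    -- itself an element of the product.
    uniformize : ∀ {m} (Φ : Formula L P (suc m)) → IsΣ (suc n) Φ → (ρ : Vec D m) →
      C ⊆* Holds (∃′ Φ) ρ → ∃ λ φ → C ⊆* Holds Φ (φ ∷ ρ)
    uniformize Φ h ρ p = φ , ⊆*-mono holds C⊆dom
      where
      -- Here `tl z` is the verification, its second entry is the number of witnesses, and the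
      -- outermost of these stands last among them.
      witnessᴿ : Rec {2} λ xs → nth (pred (hd (tl (tl (lookup xs zero))))) (tl (tl (tl (lookup xs zero))))
      witnessᴿ = nthᴿ (predᴿ (hdᴿ (tlᴿ (tlᴿ x₀)))) (tlᴿ (tlᴿ (tlᴿ x₀)))
      c = Σ-search (∃′ Φ) (∃Σ h) ρ witnessᴿ
      C⊆dom : C ⊆* dom c
      C⊆dom = ⊆*-mono (λ (complete , holds) → complete holds) (⊆*-∩ (Σ-search-complete (∃′ Φ) (∃Σ h) ρ witnessᴿ) p)
      sound : ∀ {i a} → c [ i ∷ [] ]↓ a → ∃ λ a∈ → Sat (A.structure i) (e i) Φ ((a , a∈) ∷ vals ρ i)
      sound {i} d =
        let z , v , a≡ = Σ-search-sound (∃′ Φ) (∃Σ h) ρ witnessᴿ d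
        in subst (λ a → ∃ λ a∈ → Sat (A.structure i) (e i) Φ ((a , a∈) ∷ vals ρ i)) a≡
             (Verifies-sound-∃ h {vals ρ i} {tl z} v)
      φ : D
      φ = record { code = c ; inDomain = proj₁ ∘ sound ; C⊆*dom = C⊆dom }
      holds : ∀ {i} → dom c i → Holds Φ (φ ∷ ρ) i
      holds {i} (a , d) = let a∈ , s = sound d in
        subst (λ b → Sat (A.structure i) (e i) Φ (b ∷ vals ρ i)) (elem-injective (A i) (sym (val↓ φ d))) s

    eval-val : ∀ {m} (ρ : Vec D m) (t : Term L P m) →
      C ⊆* λ i → val (eval product E ρ t) i ≡ eval (A.structure i) (e i) (vals ρ i) t
    evals-vals : ∀ {m k} (ρ : Vec D m) (ts : Vec (Term L P m) k) →
      C ⊆* λ i → vals (evals product E ρ ts) i ≡ evals (A.structure i) (e i) (vals ρ i) ts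
    eval-val ρ (var x)    = ⊆*-universal λ i → sym (lookup-map x (λ φ → val φ i) ρ)
    eval-val ρ (par q)    = ⊆*-mono sym (to (=C⇔ (ψ q) (E q)) (ψ=E q))
    eval-val ρ (app f ts) = ⊆*-mono
      (λ {i} ((as , ds) , vs≡) → elem-injective (A i) (trans (val↓ (funD f _) (funC↓ f ds))
        (cong (λ bs → proj₁ (A.fun i f bs)) (trans (vals⇓ ds) vs≡))))
      (⊆*-∩ (allDefined (evals product E ρ ts)) (evals-vals ρ ts))
    evals-vals ρ []       = ⊆*-universal λ _ → refl
    evals-vals ρ (t ∷ ts) = ⊆*-mono (λ (p , q) → cong₂ _∷_ p q) (⊆*-∩ (eval-val ρ t) (evals-vals ρ ts))

    Transfers : ∀ {m} → Formula L P m → Set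
    Transfers Φ = ∀ ρ → Sat product E Φ ρ ⇔ (C ⊆* Holds Φ ρ)

    private
      qf-Σ : ∀ {m} {Φ : Formula L P m} → QuantifierFree Φ → IsΣ (suc n) Φ
      qf-Σ q = Σ-mono (z≤′n) (qf q)

    -- Conjunction only intersects two sets containing almost all of C; negation and disjunction
    -- need the dichotomy `decided`.
    łoś-qf : ∀ {m} {Φ : Formula L P m} → QuantifierFree Φ → Transfers Φ
    łoś-qf (eq {t} {u}) ρ = mk⇔
      (λ p → ⊆*-mono (λ (t≡ , u≡ , v≡) → trans (sym t≡) (trans v≡ u≡))
        (⊆*-∩ (eval-val ρ t) (⊆*-∩ (eval-val ρ u) (to (=C⇔ _ _) p))))
      (λ p → from (=C⇔ _ _) (⊆*-mono (λ (t≡ , u≡ , v≡) → trans t≡ (trans v≡ (sym u≡)))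
        (⊆*-∩ (eval-val ρ t) (⊆*-∩ (eval-val ρ u) p))))
    łoś-qf (atom {r} {ts}) ρ = mk⇔
      (λ p → ⊆*-mono (λ {i} (ts≡ , h) → subst (A.rel i r) ts≡ h)
        (⊆*-∩ (evals-vals ρ ts) (to (relD⇔ r _) p)))
      (λ p → from (relD⇔ r _) (⊆*-mono (λ {i} (ts≡ , h) → subst (A.rel i r) (sym ts≡) h)
        (⊆*-∩ (evals-vals ρ ts) p)))
    łoś-qf (neg {Φ} q) ρ = mk⇔
      (λ ¬sat → Sum.[ (λ p → ⊥-elim (¬sat (from (łoś-qf q ρ) p))) , id ]′ (decided Φ (qf-Σ q) ρ))
      (λ p sat → ⊆*-disjoint (to (łoś-qf q ρ) sat) p)
    łoś-qf (and q q′) ρ = mk⇔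
      (λ (s , s′) → ⊆*-∩ (to (łoś-qf q ρ) s) (to (łoś-qf q′ ρ) s′))
      (λ p → from (łoś-qf q ρ) (⊆*-mono proj₁ p) , from (łoś-qf q′ ρ) (⊆*-mono proj₂ p))
    łoś-qf (or {Φ} q q′) ρ = mk⇔
      Sum.[ ⊆*-mono inj₁ ∘ to (łoś-qf q ρ) , ⊆*-mono inj₂ ∘ to (łoś-qf q′ ρ) ]′
      (λ p → Sum.map (from (łoś-qf q ρ))
        (λ no-Φ → from (łoś-qf q′ ρ) (⊆*-mono (λ (h , ¬Φ) → Sum.[ ⊥-elim ∘ ¬Φ , id ]′ h) (⊆*-∩ p no-Φ)))
        (decided Φ (qf-Σ q) ρ))

    łoś-Σ : ∀ {k m} {Φ : Formula L P m} → k ≤ suc n → IsΣ k Φ → Transfers Φ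
    łoś-Π : ∀ {k m} {Φ : Formula L P m} → k ≤ suc n → IsΠ k Φ → Transfers Φ
    łoś-Σ k≤ (qf q)    = łoś-qf q
    łoś-Σ k≤ (fromΠ h) = łoś-Π (<⇒≤ k≤) h
    łoś-Σ k≤ (∃Σ {Φ = Φ} h) ρ = mk⇔
      (λ (φ , sat) → ⊆*-mono (λ {i} s → val φ i , s) (to (łoś-Σ k≤ h (φ ∷ ρ)) sat))
      (λ p → let φ , p′ = uniformize Φ (Σ-mono (≤⇒≤′ k≤) h) ρ p in φ , from (łoś-Σ k≤ h (φ ∷ ρ)) p′)
    łoś-Π k≤ (qf q)    = łoś-qf q
    łoś-Π k≤ (fromΣ h) = łoś-Σ (<⇒≤ k≤) h
    -- If counterexamples existed at almost all i in C, `uniformize` applied to the dual would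
    -- assemble them into one element of the product, against the assumption. Otherwise almost all
    -- of C has none.
    łoś-Π k≤ (∀Π {Φ = Φ} h) ρ with dualΠ em h
    ... | Ψ , h′ , dual = mk⇔
      (λ sat → Sum.[
        (λ p → let φ , p′ = uniformize Ψ Ψ-Σ ρ p in ⊥-elim (⊆*-disjoint (to (łoś-Π k≤ h (φ ∷ ρ)) (sat φ))
          (⊆*-mono (λ {i} → to (dual (A.structure i) (e i) _)) p′))) ,
        ⊆*-mono (λ {i} none a → stable em λ ¬Φ → none (a , from (dual (A.structure i) (e i) _) ¬Φ)) ]′
        (decided (∃′ Ψ) (∃Σ Ψ-Σ) ρ))
      (λ p φ → from (łoś-Π k≤ h (φ ∷ ρ)) (⊆*-mono (λ {i} all → all (val φ i)) p))
      where
      Ψ-Σ : IsΣ (suc n) Ψ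
      Ψ-Σ = Σ-mono (≤⇒≤′ k≤) h′

-- Realization of types

∃∀-form : ∀ {C} → Σ⁰ 2 (unary C) → ∃ λ (R : Pred (Vec ℕ 3) 0ℓ) → Computable R ×
  (∀ i → C i ⇔ (∃ λ a → ∀ b → R (b ∷ a ∷ i ∷ [])))
∃∀-form (Q , (R , R-computable , Q⇔) , C⇔) = R , lower R-computable , λ i → mk⇔
  (λ c → let a , q = to (C⇔ (i ∷ [])) c in a , to (Q⇔ _) q)
  (λ (a , r) → from (C⇔ (i ∷ [])) (a , from (Q⇔ _) r))

list-bounded : ∀ (l : List ℕ) → ∃ λ s → ∀ {i} → i ∈ˡ l → i < s
list-bounded List.[]       = 0 , λ ()
list-bounded (x List.∷ xs) with list-bounded xs
... | s , below = suc x ⊔ s , λ { (here refl) → m≤m⊔n (suc x) s ; (there i∈) → ≤-trans (below i∈) (m≤n⊔m (suc x) s) }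

module Realization (em : ExcludedMiddle 0ℓ) {L : Language} (n : ℕ) (A : ℕ → ℕStructure L)
  (A-decidable : UniformlyDecidable A n) (C : Pred ℕ 0ℓ) (C-cohesive : Cohesive C)
  (R : Pred (Vec ℕ 3) 0ℓ) (R-computable : Computable R)
  (C⇔ : ∀ i → C i ⇔ (∃ λ a → ∀ b → R (b ∷ a ∷ i ∷ []))) where

  open CohesiveProduct A (proj₁ A-decidable) C
  open Łoś em n A A-decidable C C-cohesive
  private module A i = ℕStructure (A i)

  ⊆*-infinite : ∀ {Y} → C ⊆* Y → ∀ s → ∃ λ i → C i × s ≤ i × Y i
  ⊆*-infinite {Y} (l , sub) s = stable em λ none → proj₁ C-cohesive
    (l List.++ upTo s , λ {i} c → Sum.[
      (λ s≤i → ∈-++⁺ˡ (sub (c , λ y → none (i , c , s≤i , y)))) ,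
      (λ i<s → ∈-++⁺ʳ l (∈-upTo⁺ i<s)) ]′ (≤-<-connex s i))

  module Type {P : Set} (index : P → ℕ) (E ψ : P → D) (ψ=E : ∀ q → ψ q =C E q)
    (parameter : ℕ → ℕ → ℕ → ℕ)
    (parameterᴿ : Rec {3} (λ xs → parameter (lookup xs zero) (lookup xs (suc zero)) (lookup xs (suc (suc zero)))))
    (parameter-sound : ∀ t q i {a} → parameter t (index q) i ≡ suc a → D.code (ψ q) [ i ∷ [] ]↓ a)
    (parameter-defined : ∀ ℓ → C ⊆* λ i → Eventually (λ t → parameter t ℓ i ≢ 0))
    (m : ℕ) (p : Pred (Formula L P m) 0ℓ) (p-satisfied : FinitelySatisfied product E p)
    (p-Σ : ∀ Φ → p Φ → IsΣ (suc n) Φ) (p-computable : Computable (CodesOf index p)) where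

    open Parametrized index E ψ ψ=E parameter parameterᴿ parameter-sound parameter-defined

    private
      InType : ℕ → Set
      InType c = CodesOf index p (c ∷ [])

    IsTuple : ℕ → ℕ → ℕ → Set
    IsTuple i k x = drop k x ≡ 0 × (∀ j → j < k → IsEntry i (drop j x))

    drop-tl : ∀ j x → drop j (tl x) ≡ drop (suc j) x
    drop-tl zero    x = refl
    drop-tl (suc j) x = cong tl (drop-tl j x)

    tuple : ∀ {i} k x → IsTuple i k x → ∃ λ (ρ : Vec (A.Elem i) k) → x ≡ enc i ρ
    tuple zero    x (x≡0 , _) = [] , x≡0
    tuple {i} (suc k) x (drop≡0 , entries)
      with ρ , tl≡ ← tuple {i} k (tl x) (trans (drop-tl k x) drop≡0 ,
             λ j j<k → subst (IsEntry i) (sym (drop-tl j x)) (entries (suc j) (s≤s j<k)))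
      = (_ , proj₂ (entries 0 (s≤s z≤n))) ∷ ρ ,
        trans (proj₁ (entries 0 (s≤s z≤n))) (trans (cong (cons (hd x)) tl≡) (sym (encode-∷ (hd x) (A.values i ρ))))

    isTuple : ∀ {i k} (ρ : Vec (A.Elem i) k) → IsTuple i k (enc i ρ)
    isTuple []      = refl , λ _ ()
    isTuple {i} {suc k} (a ∷ ρ) with isTuple ρ
    ... | drop≡0 , entries = trans (drop≡ k) drop≡0 , λ
      { zero    _         → trans enc≡ (sym (cong₂ cons hd≡ (drop≡ 0))) , subst (T ∘ A.domain i) (sym hd≡) (proj₂ a)
      ; (suc j) (s≤s j<k) → subst (IsEntry i) (sym (drop≡ j)) (entries j j<k) }
      where
      enc≡ : enc i (a ∷ ρ) ≡ cons (proj₁ a) (enc i ρ)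
      enc≡ = encode-∷ (proj₁ a) (A.values i ρ)
      hd≡ : hd (enc i (a ∷ ρ)) ≡ proj₁ a
      hd≡ = trans (cong hd enc≡) (hd-cons _ _)
      drop≡ : ∀ j → drop (suc j) (enc i (a ∷ ρ)) ≡ drop j (enc i ρ)
      drop≡ j = trans (cong (drop (suc j)) enc≡) (drop-cons j _ _)

    -- A candidate q lists an index i, a witness a for i ∈ C, a tuple x from the i-th structure, and w.
    tupleOf boundOf : ℕ → ℕ
    tupleOf q = hd (tl (tl q))
    boundOf q = tl (tl (tl q))

    -- `s ∸ i ≡ 0` expresses s ≤ i. The number w is a common bound on the verifications, which keeps
    -- the condition computable.
    Valid : ℕ → ℕ → ℕ → ℕ → Set
    Valid s i x w = s ∸ i ≡ 0 × IsTuple i m x ×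
      (∀ c → c < s → InType c → ∃ λ w′ → w′ < w × Verifies i c x w′)

    IsCandidate : ℕ → ℕ → Set
    IsCandidate s q = Valid s (hd q) (tupleOf q) (boundOf q)

    Refuted : ℕ → ℕ → Set
    Refuted b q = ∃ λ b′ → b′ < b × ¬ R (b′ ∷ hd (tl q) ∷ hd q ∷ [])

    Selects : ℕ → ℕ → ℕ → Set
    Selects s q b = IsCandidate s q × (∀ q′ → q′ < q → IsCandidate s q′ → Refuted b q′)

    -- z lists s, a candidate q, and a bound b for the refutations of the candidates before q;
    -- bounding them makes selection computable.
    Finds : ℕ → ℕ → Set
    Finds z i = hd (hd (tl z)) ≡ i × Selects (hd z) (hd (tl z)) (tl (tl z))

    IsCandidateᶜ : Computable {2} λ xs → IsCandidate (lookup xs zero) (lookup xs (suc zero))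
    IsCandidateᶜ =
      (x₀ ∸ᴿ hdᴿ x₁ ≡ᶜ const 0) ×ᶜ
      ((dropᴿ (const m) x ≡ᶜ const 0) ×ᶜ ∀<ᶜ (const m) (Entryᶜ (hdᴿ x₂) (dropᴿ x₀ (hdᴿ (tlᴿ (tlᴿ x₂)))))) ×ᶜ
      ∀<ᶜ x₀ ((p-computable ∙ (x₀ ∷ᴿ []ᴿ)) →ᶜ
        ∃<ᶜ (tlᴿ (tlᴿ (tlᴿ x₂))) (Verifiesᶜ ∙ (hdᴿ x₃ ∷ᴿ x₁ ∷ᴿ hdᴿ (tlᴿ (tlᴿ x₃)) ∷ᴿ x₀ ∷ᴿ []ᴿ)))
      where
      x = hdᴿ (tlᴿ (tlᴿ (x₁ {0})))

    Findsᶜ : Computable {2} λ xs → Finds (lookup xs zero) (lookup xs (suc zero))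
    Findsᶜ =
      (hdᴿ (hdᴿ (tlᴿ x₀)) ≡ᶜ x₁) ×ᶜ
      (IsCandidateᶜ ∙ (hdᴿ x₀ ∷ᴿ hdᴿ (tlᴿ x₀) ∷ᴿ []ᴿ)) ×ᶜ
      ∀<ᶜ (hdᴿ (tlᴿ x₀)) ((IsCandidateᶜ ∙ (hdᴿ x₁ ∷ᴿ x₀ ∷ᴿ []ᴿ)) →ᶜ
        ∃<ᶜ (tlᴿ (tlᴿ x₁)) (¬ᶜ (R-computable ∙ (x₀ ∷ᴿ hdᴿ (tlᴿ x₁) ∷ᴿ hdᴿ x₁ ∷ᴿ []ᴿ))))

    IsTrue : ℕ → ℕ → Set
    IsTrue s q = IsCandidate s q × (∀ b → R (b ∷ hd (tl q) ∷ hd q ∷ []))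

    private
      typeBelow : ∀ s → ∃ λ Φs → All p Φs ×
        (∀ c → c < s → InType c → ∃ λ Φ → Φ ∈ˡ Φs × codeFormula index Φ ≡ c)
      typeBelow zero    = List.[] , All.[] , λ _ ()
      typeBelow (suc s) with typeBelow s | decide p-computable (s ∷ [])
      ... | Φs , ps , all | no s∉ = Φs , ps , λ c c≤s c∈ → Sum.[
              (λ c<s → all c c<s c∈) , (λ { refl → ⊥-elim (s∉ c∈) }) ]′ (m≤n⇒m<n∨m≡n (≤-pred c≤s))
      ... | Φs , ps , all | yes (Φ , pΦ , code≡) = Φ List.∷ Φs , pΦ All.∷ ps , λ c c≤s c∈ → Sum.[
              (λ c<s → let Φ′ , Φ′∈ , code≡′ = all c c<s c∈ in Φ′ , there Φ′∈ , code≡′) ,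
              (λ { refl → Φ , here refl , code≡ }) ]′ (m≤n⇒m<n∨m≡n (≤-pred c≤s))

      verified : ∀ s → ∃ λ (ρ : Vec D m) → C ⊆* λ i → ∀ c → c < s → InType c →
        ∃ λ w → Verifies i c (enc i (vals ρ i)) w
      verified s with typeBelow s
      ... | Φs , ps , all with p-satisfied Φs ps
      ...   | ρ , sats = ρ , ⊆*-∀< s each
        where
        holds : ∀ Φ → Φ ∈ˡ Φs → C ⊆* λ i → ∃ λ w → Verifies i (codeFormula index Φ) (enc i (vals ρ i)) w
        holds Φ Φ∈ = ⊆*-mono
          (λ {i} (h , t , defined) → let w , v = Verifies-complete Φ-Σ {vals ρ i} defined h in cons t w , v)
          (⊆*-∩ (to (łoś-Σ ≤-refl Φ-Σ ρ) (All.lookup sats Φ∈)) (parametersDefined (codeFormula index Φ)))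
          where Φ-Σ = p-Σ Φ (All.lookup ps Φ∈)
        each : ∀ c → c < s → C ⊆* λ i → InType c → ∃ λ w → Verifies i c (enc i (vals ρ i)) w
        each c c<s with decide p-computable (c ∷ [])
        ... | no c∉  = ⊆*-universal λ _ c∈ → ⊥-elim (c∉ c∈)
        ... | yes c∈ = let Φ , Φ∈ , code≡ = all c c<s c∈ in
          ⊆*-mono (λ {i} h _ → subst (λ c → ∃ λ w → Verifies i c (enc i (vals ρ i)) w) code≡ h) (holds Φ Φ∈)

      components : ∀ (X : ℕ → ℕ → ℕ → ℕ → Set) i a x w → X i a x w →
        let q = cons i (cons a (cons x w)) in X (hd q) (hd (tl q)) (tupleOf q) (boundOf q)
      components X i a x w h
        = subst₂ (λ i q → X i (hd q) (hd (tl q)) (tl (tl q))) (sym (hd-cons i _)) (sym (tl-cons i _))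
         (subst₂ (λ a q → X i a (hd q) (tl q)) (sym (hd-cons a _)) (sym (tl-cons a _))
         (subst₂ (X i a) (sym (hd-cons x w)) (sym (tl-cons x w)) h))

    true-exists : ∀ s → ∃ (IsTrue s)
    true-exists s =
      let ρ , almost-verified = verified s
          i , i∈C , s≤i , verified-i = ⊆*-infinite almost-verified s
          a , r = to (C⇔ i) i∈C
          x = enc i (vals ρ i)
          w , verified-w = eventually-∀< s (bounded {i} {x} s verified-i)
      in cons i (cons a (cons x w)) ,
         components (λ i a x w → Valid s i x w × (∀ b → R (b ∷ a ∷ i ∷ []))) i a x w
           ((m≤n⇒m∸n≡0 s≤i , isTuple (vals ρ i) , verified-w w ≤-refl) , r)
      where
      bounded : ∀ {i x} s → (∀ c → c < s → InType c → ∃ λ w → Verifies i c x w) →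
        ∀ c → c < s → Eventually λ w → InType c → ∃ λ w′ → w′ < w × Verifies i c x w′
      bounded s verified-i c c<s with decide p-computable (c ∷ [])
      ... | no c∉  = 0 , λ _ _ c∈ → ⊥-elim (c∉ c∈)
      ... | yes c∈ = let w , v = verified-i c c<s c∈ in suc w , λ _ w< _ → w , w< , v

    leastTrue : ∀ s → ∃ λ q → IsTrue s q × (∀ q′ → q′ < q → ¬ IsTrue s q′)
    -- Truth of a candidate is not decided by computation, so the minimum is taken classically; the
    -- code for the tuple does not refer to it.
    leastTrue s = let q , true = true-exists s in least (λ _ → em) q true

    -- No candidate before the least true one is true, so each has a refutation; as there are
    -- finitely many, one b bounds all of these.
    true-index : ∀ s → ∃ λ i → C i × s ≤ i × ∃ λ z → Finds z i
    true-index s = hd q , from (C⇔ (hd q)) (_ , true) , m∸n≡0⇒m≤n (proj₁ candidate) ,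
      cons s (cons q b) , cong hd (trans (cong hd (tl-cons s (cons q b))) (hd-cons q b)) ,
      subst₂ (λ s v → Selects s (hd v) (tl v)) (sym (hd-cons s (cons q b))) (sym (tl-cons s (cons q b)))
        (subst₂ (Selects s) (sym (hd-cons q b)) (sym (tl-cons q b)) (candidate , refuted b ≤-refl))
      where
      q = proj₁ (leastTrue s)
      candidate = proj₁ (proj₁ (proj₂ (leastTrue s)))
      true = proj₂ (proj₁ (proj₂ (leastTrue s)))
      minimal = proj₂ (proj₂ (leastTrue s))
      refutation : ∀ q′ → q′ < q → Dec (IsCandidate s q′) → Eventually λ b → IsCandidate s q′ → Refuted b q′
      refutation q′ q′<q (no ¬candidate) = 0 , λ _ _ candidate → ⊥-elim (¬candidate candidate)
      refutation q′ q′<q (yes candidate) =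
        let b , ¬r = stable em (λ none → minimal q′ q′<q (candidate , λ b → stable em λ ¬r → none (b , ¬r)))
        in suc b , λ _ b< _ → b , b< , ¬r
      eventually = eventually-∀< q (λ q′ q′<q → refutation q′ q′<q em)
      b = proj₁ eventually
      refuted = proj₂ eventually

    Selects⇒≤ : ∀ {s q b} → Selects s q b → q ≤ proj₁ (leastTrue s)
    Selects⇒≤ {s} (_ , refuted) = ≮⇒≥ λ q*<q →
      let _ , (candidate , true) , _ = leastTrue s
          b′ , _ , ¬r = refuted _ q*<q candidate
      in ¬r (true b′)

    private
      found = search Findsᶜ (hdᴿ (tlᴿ (tlᴿ (hdᴿ (tlᴿ x₀)))))

    tupleCode : Code 1
    tupleCode = proj₁ found

    tupleCode-sound : ∀ {i x} → tupleCode [ i ∷ [] ]↓ x → ∃₂ λ s q → q ≤ proj₁ (leastTrue s) × hd q ≡ i ×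
      IsTuple i m x × (∀ c → c < s → InType c → ∃ λ w → Verifies i c x w)
    tupleCode-sound {i} {x} d =
      let z , (i≡ , selects) , x≡ = proj₁ (proj₂ found) d
          _ , isTuple , verifies = subst₂ (λ i x → Valid (hd z) i x (boundOf (hd (tl z)))) i≡ x≡ (proj₁ selects)
      in hd z , hd (tl z) , Selects⇒≤ selects , i≡ , isTuple ,
         λ c c<s c∈ → let w , _ , v = verifies c c<s c∈ in w , v

    C⊆dom-tupleCode : C ⊆* dom tupleCode
    C⊆dom-tupleCode = Sum.[ id , (λ (l , sub) →
        let s , below = list-bounded l
            i , i∈C , s≤i , z , finds = true-index s
        in ⊥-elim (<⇒≱ (below (sub (i∈C , λ ∉dom → ∉dom (proj₂ (proj₂ found) finds)))) s≤i)) ]′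
      (proj₂ C-cohesive (dom tupleCode) (tupleCode , id , id))

    entryᴿ : (j : Fin m) → Rec {1} (λ xs → nth (toℕ j) (lookup xs zero))
    entryᴿ j = nthᴿ (const (toℕ j)) x₀

    realizer : Fin m → D
    realizer j = record
      { code     = comp (Rec.code (entryᴿ j)) (tupleCode ∷ [])
      ; inDomain = λ { {i} (comp↓ (d ∷ []) d′) →
          let _ , _ , _ , _ , (_ , entries) , _ = tupleCode-sound d
          in subst (T ∘ A.domain i) (↓-functional (code↓ (entryᴿ j) _) d′) (proj₂ (entries (toℕ j) (toℕ<n j))) }
      ; C⊆*dom   = ⊆*-mono (λ (x , d) → _ , comp↓ (d ∷ []) (code↓ (entryᴿ j) _)) C⊆dom-tupleCode
      }

    vals-realizer : ∀ {i ρ} → tupleCode [ i ∷ [] ]↓ enc i ρ → ρ ≡ vals (tabulate realizer) i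
    vals-realizer {i} {ρ} d = sym (trans (sym (tabulate-∘ (λ φ → val φ i) realizer))
      (trans (tabulate-cong λ j → elem-injective (A i)
        (trans (val↓ (realizer j) (comp↓ (d ∷ []) (code↓ (entryᴿ j) _)))
          (trans (nth-encode j (A.values i ρ)) (lookup-map j proj₁ ρ))))
        (tabulate∘lookup ρ)))

    realized : Realized product E p
    realized = tabulate realizer , λ Φ pΦ → from (łoś-Σ ≤-refl (p-Σ Φ pΦ) (tabulate realizer)) (holds Φ pΦ)
      where
      holds : ∀ Φ → p Φ → C ⊆* Holds Φ (tabulate realizer)
      holds Φ pΦ = ⊆*-mono sound (⊆*-∩ C⊆dom-tupleCode late)
        where
        c = codeFormula index Φ
        -- N bounds the least true candidates for all s ≤ c. An i that no q ≤ N lists can be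
        -- selected only at some s > c, and then its tuple has been verified against Φ. Finitely
        -- many i are lost.
        bounds = eventually-∀< {λ s N → proj₁ (leastTrue s) ≤ N} (suc c) (λ s _ → proj₁ (leastTrue s) , λ _ → id)
        N = proj₁ bounds
        late : C ⊆* λ i → ∀ q → q ≤ N → hd q ≢ i
        late = List.map hd (upTo (suc N)) , λ {i} (_ , ¬late) →
          let q , q≤ , i≡ = stable em (λ none → ¬late λ q q≤ i≡ → none (q , q≤ , i≡))
          in subst (_∈ˡ List.map hd (upTo (suc N))) i≡ (∈-map⁺ hd (∈-upTo⁺ (s≤s q≤)))
        sound : ∀ {i} → dom tupleCode i × (∀ q → q ≤ N → hd q ≢ i) → Holds Φ (tabulate realizer) i
        sound {i} ((x , d) , i-late) =
          let s , q , q≤ , i≡ , isTuple , verifies = tupleCode-sound d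
              c<s = ≰⇒> λ s≤c → i-late q (≤-trans q≤ (proj₂ bounds N ≤-refl s (s≤s s≤c))) i≡
              ρ , x≡ = tuple m x isTuple
              w , v = verifies c c<s (Φ , pΦ , refl)
          in subst (Sat (A.structure i) (e i) Φ) (vals-realizer (subst (tupleCode [ i ∷ [] ]↓_) x≡ d))
               (Verifies-sound (p-Σ Φ pΦ) {ρ} {w} (subst (λ x → Verifies i c x w) x≡ v))

  -- Uniform sequences and finite sets of parameters

  realizesOverUniformSequences : RealizesOverUniformSequences (suc n)
  realizesOverUniformSequences E (ψ , e , ψ=E , e⇔ψ) = Type.realized id E ψ ψ=E
    (λ t ℓ i → run e t (ℓ ∷ i ∷ [])) (runᴿ e · (x₀ ∷ᴿ x₁ ∷ᴿ x₂ ∷ᴿ []ᴿ))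
    (λ t ℓ i r≡ → to (e⇔ψ ℓ i _) (run-sound e t r≡))
    (λ ℓ → ⊆*-mono
      (λ {i} (a , d) → eventually-map (λ r≡ r≡0 → 0≢1+n (trans (sym r≡0) r≡)) (run-complete (from (e⇔ψ ℓ i a) d)))
      (D.C⊆*dom (ψ ℓ)))

  -- Beyond the N parameters the result is 1, that is, defined with the junk value 0, because
  -- `ParametersDefined` asks for every index up to a bound.
  finiteValue : ∀ {N} → (Fin N → D) → ℕ → ℕ → ℕ → ℕ
  finiteValue {zero}  E t ℓ i = 1
  finiteValue {suc N} E t ℓ i = ifz ℓ (run (D.code (E zero)) t (i ∷ [])) (finiteValue (E ∘ suc) t (pred ℓ) i)

  finiteValueᴿ : ∀ {N} (E : Fin N → D) →
    Rec {3} (λ xs → finiteValue E (lookup xs zero) (lookup xs (suc zero)) (lookup xs (suc (suc zero))))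
  finiteValueᴿ {zero}  E = const 1
  finiteValueᴿ {suc N} E = ifzᴿ x₁ (runᴿ (D.code (E zero)) · (x₀ ∷ᴿ x₂ ∷ᴿ []ᴿ))
    (finiteValueᴿ (E ∘ suc) · (x₀ ∷ᴿ predᴿ x₁ ∷ᴿ x₂ ∷ᴿ []ᴿ))

  finiteValue-sound : ∀ {N} (E : Fin N → D) t q i {a} → finiteValue E t (toℕ q) i ≡ suc a →
    D.code (E q) [ i ∷ [] ]↓ a
  finiteValue-sound E t zero    i v≡ = run-sound (D.code (E zero)) t v≡
  finiteValue-sound E t (suc q) i v≡ = finiteValue-sound (E ∘ suc) t q i v≡

  finiteValue-defined : ∀ {N} (E : Fin N → D) ℓ → C ⊆* λ i → Eventually (λ t → finiteValue E t ℓ i ≢ 0)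
  finiteValue-defined {zero}  E ℓ       = ⊆*-universal λ _ → 0 , λ _ _ ()
  finiteValue-defined {suc N} E zero    = ⊆*-mono
    (λ (a , d) → eventually-map (λ r≡ r≡0 → 0≢1+n (trans (sym r≡0) r≡)) (run-complete d)) (D.C⊆*dom (E zero))
  finiteValue-defined {suc N} E (suc ℓ) = finiteValue-defined (E ∘ suc) ℓ

  recursivelySaturated : ΣRecursivelySaturated (suc n) product
  recursivelySaturated N E = Type.realized toℕ E E (λ q → IsEquivalence.refl =C-equivalence {E q})
    (finiteValue E) (finiteValueᴿ E) (finiteValue-sound E) (finiteValue-defined E)

theorem2p6 : ExcludedMiddle 0ℓ →
    (L : Language) → ComputableLanguage L →
    (C : Pred ℕ 0ℓ) → Δ⁰ 2 C → Cohesive C →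
    (n : ℕ) →
    ((A : ℕ → ℕStructure L) ((A-computable , _) : UniformlyDecidable A n) →
    let open CohesiveProduct A A-computable C in
    RealizesOverUniformSequences (suc n) × ΣRecursivelySaturated (suc n) product)
    ×
    ((A : ℕStructure L) ((A-computable , _) : Decidable A n) →
    let open CohesivePower A A-computable C in
    RealizesOverUniformSequences (suc n) × ΣRecursivelySaturated (suc n) product)
theorem2p6 em L _ C (C-Σ₂ , _) C-cohesive n = let _ , R-computable , C⇔ = ∃∀-form C-Σ₂ in
  (λ A A-decidable → let open Realization em n A A-decidable C C-cohesive _ R-computable C⇔ in
    realizesOverUniformSequences , recursivelySaturated) ,
  (λ A (A-computable , diagram-computable) →
    let open Realization em n (λ _ → A) (isComputable-const A-computable , computable-const diagram-computable)
          C C-cohesive _ R-computable C⇔ in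
    realizesOverUniformSequences , recursivelySaturated)
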